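{- Let $\mathscr{A}$ and $\mathscr{B}$ be two cross-intersecting Sperner families on $\mathbb{N}_n$, where $n\ge 4$ is an even integer. Then $|\mathscr{A}|+|\mathscr{B}|=\binom{n}{n/2}+\binom{n}{(n/2)+1}-1$ if and only if (i) $\mathscr{A}=\binom{\mathbb{N}_n}{n/2}$, $\mathscr{B}\subset\binom{\mathbb{N}_n}{(n/2)+1}$ and $|\mathscr{B}|=\binom{n}{(n/2)+1}-1$, or (ii) $\mathscr{A}\subset\binom{\mathbb{N}_n}{n/2}$, $|\mathscr{A}|=\binom{n}{n/2}-1$, and $\mathscr{B}=\binom{\mathbb{N}_n}{(n/2)+1}$.
   Context: For a positive integer $n$, $\mathbb{N}_n=\{1,2,\ldots,n\}$, and for $0\le k\le n$, $\binom{\mathbb{N}_n}{k}$ denotes the collection of all $k$-element subsets of $\mathbb{N}_n$. A Sperner family (or antichain) on $\mathbb{N}_n$ is a collection $\mathscr{F}$ of subsets of $\mathbb{N}_n$ such that $X\not\subseteq Y$ for all distinct $X,Y\in\mathscr{F}$. Two families $\mathscr{A},\mathscr{B}\subseteq 2^{\mathbb{N}_n}$ (where $2^{\mathbb{N}_n}$ is the power set of $\mathbb{N}_n$) are cross-intersecting if $A\cap B\neq\emptyset$ for all $A\in\mathscr{A}$ and all $B\in\mathscr{B}$.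
   Formalization: The characterization is proved up to interchanging 𝒜 and ℬ: (i) or (ii) holds for (𝒜,ℬ) or for (ℬ,𝒜). With fixed labels the claim fails, e.g. n=4, 𝒜 = three of the 3-sets, ℬ = all 2-sets. -}

module Defs where

open import Data.Fin.Subset using (Subset; _∩_; Nonempty; ∣_∣) renaming (_⊈_ to _⊈ₛ_)
open import Data.List using (List; length)
open import Data.List.Membership.Propositional using () renaming (_∈_ to _∈ₗ_)
open import Data.List.Relation.Unary.Unique.Propositional using (Unique)
open import Data.Nat using (ℕ; _+_; _∸_; _/_)
open import Data.Nat.Combinatorics using (_C_)
open import Data.Product using (_×_)
open import Data.Sum using (_⊎_)
open import Level using (0ℓ)
open import Relation.Binary.PropositionalEquality using (_≡_; _≢_)
open import Relation.Unary using (Pred; _≐_; _⊂_)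

-- A family of subsets of an n-element ground set (Fin n stands for {1,…,n}).
-- The order of the listing is irrelevant: families are compared only through
-- their members, and uniqueness makes the length the cardinality.
record Family (n : ℕ) : Set where
  field
    sets   : List (Subset n)
    unique : Unique sets

open Family public

Members : ∀ {n} → Family n → Pred (Subset n) 0ℓ
Members 𝒜 X = X ∈ₗ sets 𝒜

size : ∀ {n} → Family n → ℕ
size 𝒜 = length (sets 𝒜)

Layer : ∀ {n} → ℕ → Pred (Subset n) 0ℓ
Layer k X = ∣ X ∣ ≡ k

Sperner : ∀ {n} → Family n → Set
Sperner 𝒜 = ∀ {X Y} → Members 𝒜 X → Members 𝒜 Y → X ≢ Y → X ⊈ₛ Y

CrossIntersecting : ∀ {n} → Family n → Family n → Set
CrossIntersecting 𝒜 ℬ = ∀ {A B} → Members 𝒜 A → Members ℬ B → Nonempty (A ∩ B)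

FullMiddle : ∀ {n} → Family n → Family n → Set
FullMiddle {n} 𝒜 ℬ =
  (Members 𝒜 ≐ Layer (n / 2)) ×
  (Members ℬ ⊂ Layer (n / 2 + 1)) ×
  (size ℬ ≡ n C (n / 2 + 1) ∸ 1)

FullUpper : ∀ {n} → Family n → Family n → Set
FullUpper {n} 𝒜 ℬ =
  (Members 𝒜 ⊂ Layer (n / 2)) ×
  (size 𝒜 ≡ n C (n / 2) ∸ 1) ×
  (Members ℬ ≐ Layer (n / 2 + 1))

-- Not symmetric in 𝒜 and ℬ, although cross-intersection and the sum of the
-- sizes are: a characterization of all pairs attaining a given sum must allow
-- the two families to be interchanged.
Extremal : ∀ {n} → Family n → Family n → Set
Extremal 𝒜 ℬ = FullMiddle 𝒜 ℬ ⊎ FullUpper 𝒜 ℬ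

{-# OPTIONS --safe #-}

-- Write n = 2m. Replacing the lowest level i < m of an antichain by its upper
-- shadow keeps it an antichain, preserves cross-intersection and gains at least
-- two sets (count the covers between level i and the shadow); dually for the
-- highest level above m + 1. So the sum of sizes is bounded by the case where both
-- families live on the levels m and m + 1, and a pair missing the bound by one
-- must already live there.
--
-- After complementing, the levels are m - 1 and m. Let R and S be the parts of
-- the two families on level m - 1, deg the number of lower covers in R (in S), and
-- p X the number of families containing X (resp. the complement of X) on level m.
-- Each X on level m satisfies
--     deg_R X + deg_S (complement of X) + m * p X <= 2m
-- because a member of an antichain has no lower cover in it. Summing gives, with
-- p <= 1, the bound C(n,m) + C(n,m+1), and when it is missed by one, the total slack plus
-- |R| + |S| equals m + C(n,m-1). If R is neither empty nor the whole level, at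
-- least m + 1 sets X have lower covers both inside and outside R, and each of them
-- has positive slack; this leaves only |R| = C(n,m-1) - 1 with S empty.

module Submission where

open import Defs
open import Algebra.Properties.CommutativeSemigroup using (interchange)
open import Data.Bool.Base using (Bool; true; false; not; _∧_; _∨_)
open import Data.Bool.Properties using (T-≡; ¬-not; not-involutive; ∧-conicalˡ; ∧-conicalʳ) renaming (_≟_ to _≟ᵇ_)
open import Data.Fin.Subset using (Subset; ∣_∣; ∁; _⊆_; _⊈_; outside; inside)
open import Data.Fin.Subset.Properties using (anySubset?; drop-∷-⊆; ⊆-refl; ⊆-reflexive; ⊆-trans; ∣p∣≤n; p⊆q⇒∣p∣≤∣q∣; ∣∁p∣≡n∸∣p∣; p⊆q⇒∁p⊇∁q; x∈p⇒x∉∁p; x∉p⇒x∈∁p; x∈p∩q⁻)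
open import Data.List.Base using (List; []; _∷_; length)
open import Data.List.Membership.Propositional using () renaming (_∈_ to _∈ₗ_)
import Data.List.Membership.DecPropositional as DecMembership
import Data.List.Relation.Unary.All as All
open import Data.List.Relation.Unary.AllPairs using ([]; _∷_)
open import Data.List.Relation.Unary.Unique.Propositional using (Unique)
open import Data.Nat
open import Data.Nat.Combinatorics using (_C_; nCk+nC[k+1]≡[n+1]C[k+1]; nCk≡nC[n∸k])
open import Data.Nat.Divisibility using (_∣_; divides)
open import Data.Nat.DivMod using (m*n/n≡m)
open import Data.Nat.Properties
open import Data.Nat.Tactic.RingSolver using (solve-∀)
open import Data.Product using (_×_; _,_; ∃; proj₁)
open import Data.Sum using (_⊎_; inj₁; inj₂; map; map₁; swap)
open import Data.Vec.Base using ([]; _∷_; here; there)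
open import Data.Vec.Properties using (≡-dec)
open import Function.Base using (_∘_; case_of_)
open import Function.Bundles using (Equivalence; _⇔_; mk⇔)
open import Relation.Binary.PropositionalEquality
open import Relation.Nullary using (¬_; Dec; yes; no; contradiction)
open import Relation.Nullary.Decidable using (⌊_⌋; _×-dec_)
open import Relation.Unary using (_≐_; _⊂_)

private
  variable
    n : ℕ

-- Sums over the power set

+-interchange : ∀ a b c d → (a + b) + (c + d) ≡ (a + c) + (b + d)
+-interchange = interchange +-commutativeSemigroup

⟦_⟧ : Bool → ℕ
⟦ true ⟧ = 1
⟦ false ⟧ = 0

⟦b⟧≤1 : ∀ b → ⟦ b ⟧ ≤ 1
⟦b⟧≤1 true = ≤-refl
⟦b⟧≤1 false = z≤n

∑ : (Subset n → ℕ) → ℕ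
∑ {zero} f = f []
∑ {suc n} f = ∑ (f ∘ (outside ∷_)) + ∑ (f ∘ (inside ∷_))

card : (Subset n → Bool) → ℕ
card f = ∑ λ X → ⟦ f X ⟧

∑-cong : {f g : Subset n → ℕ} → (∀ X → f X ≡ g X) → ∑ f ≡ ∑ g
∑-cong {zero} f≗g = f≗g []
∑-cong {suc n} f≗g = cong₂ _+_ (∑-cong (f≗g ∘ (outside ∷_))) (∑-cong (f≗g ∘ (inside ∷_)))

∑-mono : {f g : Subset n → ℕ} → (∀ X → f X ≤ g X) → ∑ f ≤ ∑ g
∑-mono {zero} f≤g = f≤g []
∑-mono {suc n} f≤g = +-mono-≤ (∑-mono (f≤g ∘ (outside ∷_))) (∑-mono (f≤g ∘ (inside ∷_)))

∑-+ : (f g : Subset n → ℕ) → ∑ (λ X → f X + g X) ≡ ∑ f + ∑ g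
∑-+ {zero} f g = refl
∑-+ {suc n} f g
  rewrite ∑-+ (f ∘ (outside ∷_)) (g ∘ (outside ∷_)) | ∑-+ (f ∘ (inside ∷_)) (g ∘ (inside ∷_))
  = +-interchange (∑ (f ∘ (outside ∷_))) (∑ (g ∘ (outside ∷_))) _ _

∑-*ˡ : ∀ c (f : Subset n → ℕ) → ∑ (λ X → c * f X) ≡ c * ∑ f
∑-*ˡ {zero} c f = refl
∑-*ˡ {suc n} c f
  rewrite ∑-*ˡ c (f ∘ (outside ∷_)) | ∑-*ˡ c (f ∘ (inside ∷_)) = sym (*-distribˡ-+ c _ _)

∑-∁ : (f : Subset n → ℕ) → ∑ (f ∘ ∁) ≡ ∑ f
∑-∁ {zero} f = refl
∑-∁ {suc n} f
  rewrite ∑-∁ (f ∘ (outside ∷_)) | ∑-∁ (f ∘ (inside ∷_)) = +-comm (∑ (f ∘ (inside ∷_))) _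

∑-0 : ∀ n → ∑ {n} (λ _ → 0) ≡ 0
∑-0 zero = refl
∑-0 (suc n) rewrite ∑-0 n = refl

term≤∑ : (f : Subset n → ℕ) → ∀ X → f X ≤ ∑ f
term≤∑ f [] = ≤-refl
term≤∑ f (outside ∷ X) = ≤-trans (term≤∑ (f ∘ (outside ∷_)) X) (m≤m+n _ _)
term≤∑ f (inside ∷ X) = ≤-trans (term≤∑ (f ∘ (inside ∷_)) X) (m≤n+m _ _)

-- The differences `g X ∸ f X` have total 0, so each of them vanishes. This turns tightness of a
-- summed bound into tightness at every set.
∑-≤-rigid : {f g : Subset n → ℕ} → (∀ X → f X ≤ g X) → ∑ g ≤ ∑ f → ∀ X → g X ≤ f X
∑-≤-rigid {f = f} {g} f≤g ∑g≤∑f X = m∸n≡0⇒m≤n (n≤0⇒n≡0 (begin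
  g X ∸ f X  ≤⟨ term≤∑ d X ⟩
  ∑ d        ≤⟨ +-cancelˡ-≤ (∑ f) (∑ d) 0 (begin
    ∑ f + ∑ d             ≡⟨ ∑-+ f d ⟨
    ∑ (λ X → f X + d X)   ≡⟨ ∑-cong (λ X → m+[n∸m]≡n (f≤g X)) ⟩
    ∑ g                   ≤⟨ ∑g≤∑f ⟩
    ∑ f                   ≡⟨ +-identityʳ _ ⟨
    ∑ f + 0               ∎) ⟩
  0          ∎))
  where
  open ≤-Reasoning
  d : Subset _ → ℕ
  d X = g X ∸ f X

-- Covers in the Boolean lattice

infix 4 _⋖_

data _⋖_ : Subset n → Subset n → Set where
  add  : {X : Subset n} → outside ∷ X ⋖ inside ∷ X
  keep : ∀ {b} {X Y : Subset n} → X ⋖ Y → b ∷ X ⋖ b ∷ Y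

⋖⇒∣∣ : {X Y : Subset n} → X ⋖ Y → ∣ Y ∣ ≡ suc ∣ X ∣
⋖⇒∣∣ add = refl
⋖⇒∣∣ (keep {b = outside} c) = ⋖⇒∣∣ c
⋖⇒∣∣ (keep {b = inside} c) = cong suc (⋖⇒∣∣ c)

⋖⇒⊆ : {X Y : Subset n} → X ⋖ Y → X ⊆ Y
⋖⇒⊆ add (there x∈X) = there x∈X
⋖⇒⊆ (keep c) here = here
⋖⇒⊆ (keep c) (there x∈X) = there (⋖⇒⊆ c x∈X)

∃⋖ : (Y : Subset n) → ∣ Y ∣ ≢ 0 → ∃ λ X → X ⋖ Y
∃⋖ [] ∣Y∣≢0 = contradiction refl ∣Y∣≢0
∃⋖ (outside ∷ Y) ∣Y∣≢0 with X , c ← ∃⋖ Y ∣Y∣≢0 = outside ∷ X , keep c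
∃⋖ (inside ∷ Y) _ = outside ∷ Y , add

-- Sums of f over the lower covers of Y, resp. over the upper covers of X.
dn : (Subset n → ℕ) → Subset n → ℕ
dn f [] = 0
dn f (outside ∷ Y) = dn (f ∘ (outside ∷_)) Y
dn f (inside ∷ Y) = f (outside ∷ Y) + dn (f ∘ (inside ∷_)) Y

up : (Subset n → ℕ) → Subset n → ℕ
up f [] = 0
up f (outside ∷ X) = f (inside ∷ X) + up (f ∘ (outside ∷_)) X
up f (inside ∷ X) = up (f ∘ (inside ∷_)) X

-- Double counting of the covers `X ⋖ Y` with weight `f X * g Y`. A cover either adds the first
-- element or keeps it, outside or inside; these are the three sums of the induction.
∑-up-dn : (f g : Subset n → ℕ) → ∑ (λ X → f X * up g X) ≡ ∑ (λ Y → dn f Y * g Y)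
∑-up-dn {zero} f g = *-zeroʳ (f [])
∑-up-dn {suc n} f g = begin
  ∑ (λ X → f₀ X * (g₁ X + up g₀ X)) + ∑ (λ X → f₁ X * up g₁ X)
    ≡⟨ cong₂ _+_ (trans (∑-cong (λ X → *-distribˡ-+ (f₀ X) (g₁ X) (up g₀ X))) (∑-+ {n} _ _)) (∑-up-dn f₁ g₁) ⟩
  ∑ (λ X → f₀ X * g₁ X) + ∑ (λ X → f₀ X * up g₀ X) + ∑ (λ X → dn f₁ X * g₁ X)
    ≡⟨ cong (λ s → ∑ (λ X → f₀ X * g₁ X) + s + ∑ (λ X → dn f₁ X * g₁ X)) (∑-up-dn f₀ g₀) ⟩
  ∑ (λ X → f₀ X * g₁ X) + ∑ (λ X → dn f₀ X * g₀ X) + ∑ (λ X → dn f₁ X * g₁ X)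
    ≡⟨ rearrange (∑ λ X → f₀ X * g₁ X) (∑ λ X → dn f₀ X * g₀ X) _ ⟩
  ∑ (λ X → dn f₀ X * g₀ X) + (∑ (λ X → f₀ X * g₁ X) + ∑ (λ X → dn f₁ X * g₁ X))
    ≡⟨ cong (∑ (λ X → dn f₀ X * g₀ X) +_)
         (trans (∑-cong (λ X → *-distribʳ-+ (g₁ X) (f₀ X) (dn f₁ X))) (∑-+ {n} _ _)) ⟨
  ∑ (λ X → dn f₀ X * g₀ X) + ∑ (λ X → (f₀ X + dn f₁ X) * g₁ X) ∎
  where
  open ≡-Reasoning
  f₀ f₁ g₀ g₁ : Subset n → ℕ
  f₀ = f ∘ (outside ∷_)
  f₁ = f ∘ (inside ∷_)
  g₀ = g ∘ (outside ∷_)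
  g₁ = g ∘ (inside ∷_)
  rearrange : ∀ a b c → a + b + c ≡ b + (a + c)
  rearrange = solve-∀

up-1 : (X : Subset n) → up (λ _ → 1) X ≡ n ∸ ∣ X ∣
up-1 [] = refl
up-1 {suc n} (outside ∷ X) = trans (cong suc (up-1 X)) (sym (+-∸-assoc 1 (∣p∣≤n X)))
up-1 (inside ∷ X) = up-1 X

dn-mono : {f g : Subset n → ℕ} → (∀ X → f X ≤ g X) → ∀ Y → dn f Y ≤ dn g Y
dn-mono f≤g [] = z≤n
dn-mono f≤g (outside ∷ Y) = dn-mono (f≤g ∘ (outside ∷_)) Y
dn-mono f≤g (inside ∷ Y) = +-mono-≤ (f≤g (outside ∷ Y)) (dn-mono (f≤g ∘ (inside ∷_)) Y)

dn-0 : (Y : Subset n) → dn (λ _ → 0) Y ≡ 0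
dn-0 [] = refl
dn-0 (outside ∷ Y) = dn-0 Y
dn-0 (inside ∷ Y) = dn-0 Y

-- Double counting with `g` constantly 1: a set of size `k` has `n ∸ k` upper covers.
∑-dn : ∀ k (f : Subset n → Bool) → (∀ {X} → f X ≡ true → ∣ X ∣ ≡ k) →
  ∑ (dn (⟦_⟧ ∘ f)) ≡ (n ∸ k) * card f
∑-dn {n} k f f-level = begin
  ∑ (dn (⟦_⟧ ∘ f))                         ≡⟨ ∑-cong (λ Y → *-identityʳ (dn (⟦_⟧ ∘ f) Y)) ⟨
  ∑ (λ Y → dn (⟦_⟧ ∘ f) Y * 1)             ≡⟨ ∑-up-dn (⟦_⟧ ∘ f) (λ _ → 1) ⟨
  ∑ (λ X → ⟦ f X ⟧ * up (λ _ → 1) X)       ≡⟨ ∑-cong degree ⟩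
  ∑ (λ X → (n ∸ k) * ⟦ f X ⟧)              ≡⟨ ∑-*ˡ (n ∸ k) (⟦_⟧ ∘ f) ⟩
  (n ∸ k) * card f                         ∎
  where
  open ≡-Reasoning
  degree : ∀ X → ⟦ f X ⟧ * up (λ _ → 1) X ≡ (n ∸ k) * ⟦ f X ⟧
  degree X with f X in eq
  ... | false = sym (*-zeroʳ (n ∸ k))
  ... | true = trans (cong (1 *_) (trans (up-1 X) (cong (n ∸_) (f-level eq)))) (*-comm 1 (n ∸ k))

dn-≤ : (f : Subset n → Bool) → ∀ Y → dn (⟦_⟧ ∘ f) Y ≤ ∣ Y ∣
dn-≤ f [] = z≤n
dn-≤ f (outside ∷ Y) = dn-≤ _ Y
dn-≤ f (inside ∷ Y) = +-mono-≤ (⟦b⟧≤1 (f (outside ∷ Y))) (dn-≤ _ Y)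

dn-> : (f : Subset n → Bool) → ∀ {X Y} → X ⋖ Y → f X ≡ true → 0 < dn (⟦_⟧ ∘ f) Y
dn-> f add fX rewrite fX = z<s
dn-> f (keep {b = outside} c) fX = dn-> _ c fX
dn-> f (keep {b = inside} c) fX = m≤n⇒m≤o+n _ (dn-> _ c fX)

dn-< : (f : Subset n → Bool) → ∀ {X Y} → X ⋖ Y → f X ≡ false → dn (⟦_⟧ ∘ f) Y < ∣ Y ∣
dn-< f (add {X = X}) fX rewrite fX = s≤s (dn-≤ _ X)
dn-< f (keep {b = outside} c) fX = dn-< _ c fX
dn-< f (keep {b = inside} {Y = Y} c) fX = +-mono-≤-< (⟦b⟧≤1 (f (outside ∷ Y))) (dn-< _ c fX)

dn-∃ : (f : Subset n → Bool) → ∀ Y → 0 < dn (⟦_⟧ ∘ f) Y → ∃ λ X → X ⋖ Y × f X ≡ true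
dn-∃ f (outside ∷ Y) 0<d with X , c , fX ← dn-∃ (f ∘ (outside ∷_)) Y 0<d = outside ∷ X , keep c , fX
dn-∃ f (inside ∷ Y) 0<d with f (outside ∷ Y) in eq
... | true = outside ∷ Y , add , eq
... | false with X , c , fX ← dn-∃ (f ∘ (inside ∷_)) Y 0<d = inside ∷ X , keep c , fX

-- Layers

layer : ℕ → Subset n → Bool
layer k X = ∣ X ∣ ≡ᵇ k

layer⇒ : ∀ k (X : Subset n) → layer k X ≡ true → ∣ X ∣ ≡ k
layer⇒ k X eq = ≡ᵇ⇒≡ _ _ (Equivalence.from T-≡ eq)

layer⇐ : ∀ k (X : Subset n) → ∣ X ∣ ≡ k → layer k X ≡ true
layer⇐ k X eq = Equivalence.to T-≡ (≡⇒≡ᵇ _ _ eq)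

dn-layer : ∀ k (Y : Subset n) → dn (⟦_⟧ ∘ layer k) Y ≡ suc k * ⟦ layer (suc k) Y ⟧
dn-layer k [] = sym (*-zeroʳ (suc k))
dn-layer k (outside ∷ Y) = dn-layer k Y
dn-layer zero (inside ∷ Y) = cong (⟦ layer 0 Y ⟧ +_) (dn-0 Y)
dn-layer (suc k) (inside ∷ Y) = cong (⟦ layer (suc k) Y ⟧ +_) (dn-layer k Y)

card-layer-0 : ∀ n → card (layer {n} 0) ≡ 1
card-layer-0 zero = refl
card-layer-0 (suc n) = cong₂ _+_ (card-layer-0 n) (∑-0 n)

card-layer : ∀ n k → card (layer {n} k) ≡ n C k
card-layer zero zero = refl
card-layer zero (suc k) = refl
card-layer (suc n) zero = trans (card-layer-0 (suc n)) refl
card-layer (suc n) (suc k) = begin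
  card (layer {n} (suc k)) + card (layer {n} k)   ≡⟨ cong₂ _+_ (card-layer n (suc k)) (card-layer n k) ⟩
  n C suc k + n C k                               ≡⟨ +-comm (n C suc k) (n C k) ⟩
  n C k + n C suc k                               ≡⟨ nCk+nC[k+1]≡[n+1]C[k+1] n k ⟩
  suc n C suc k                                   ∎
  where open ≡-Reasoning

card-layer-pos : ∀ {n k} → k ≤ n → 1 ≤ card (layer {n} k)
card-layer-pos {n} {zero} _ = ≤-reflexive (sym (card-layer-0 n))
card-layer-pos {suc n} {suc k} (s≤s k≤n) =
  m≤n⇒m≤o+n _ (card-layer-pos k≤n)

-- By Pascal's rule, where the summand from level `k` contributes at least 1 at each step. This
-- crude bound serves where a whole level has to be large.
card-layer-lower : ∀ n k → n ∸ k ≤ card (layer {n} (suc k))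
card-layer-lower zero k = ≤-trans (≤-reflexive (0∸n≡0 k)) z≤n
card-layer-lower (suc n) k with k ≤? n
... | no k≰n = ≤-trans (≤-reflexive (m≤n⇒m∸n≡0 (≰⇒> k≰n))) z≤n
... | yes k≤n = begin
  suc n ∸ k                                       ≡⟨ +-∸-assoc 1 k≤n ⟩
  1 + (n ∸ k)                                     ≤⟨ +-mono-≤ (card-layer-pos k≤n) (card-layer-lower n k) ⟩
  card (layer {n} k) + card (layer {n} (suc k))   ≡⟨ +-comm (card (layer {n} k)) _ ⟩
  card (layer {n} (suc k)) + card (layer {n} k)   ∎
  where open ≤-Reasoning

-- Isoperimetry between consecutive layers

Attains : ℕ → (Subset n → Bool) → Bool → Set
Attains i f b = ∃ λ X → ∣ X ∣ ≡ i × f X ≡ b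

attains? : ∀ i (f : Subset n → Bool) b → Dec (Attains i f b)
attains? i f b = anySubset? λ X → (∣ X ∣ ≟ i) ×-dec (f X ≟ᵇ b)

∣X∣≡0-unique : (X Y : Subset n) → ∣ X ∣ ≡ 0 → ∣ Y ∣ ≡ 0 → X ≡ Y
∣X∣≡0-unique [] [] _ _ = refl
∣X∣≡0-unique (outside ∷ X) (outside ∷ Y) p q = cong (outside ∷_) (∣X∣≡0-unique X Y p q)

-- The bound counts the sets Y on level i+1 with lower covers of both colours;
-- h is any weight that is positive on them.
bichromatic-bound : ∀ {n} i (f : Subset n → Bool) (h : Subset n → ℕ) →
  (∀ b → Attains i f b) →
  (∀ {X X′ Y} → X ⋖ Y → X′ ⋖ Y → ∣ X ∣ ≡ i → f X ≢ f X′ → 1 ≤ h Y) →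
  n ∸ i ≤ ∑ h
bichromatic-bound {zero} i f h _ _ = ≤-trans (≤-reflexive (0∸n≡0 i)) z≤n
-- Level 0 holds only the empty set, which cannot take both colours.
bichromatic-bound {suc n} zero f h att _
  with X , ∣X∣ , fX ← att true | Y , ∣Y∣ , fY ← att false
  with refl ← ∣X∣≡0-unique X Y ∣X∣ ∣Y∣ = case trans (sym fX) fY of λ ()
bichromatic-bound {suc n} (suc i) f h att pos = split (attains? i f₁ true) (attains? i f₁ false)
  where
  f₀ f₁ : Subset n → Bool
  f₀ = f ∘ (outside ∷_)
  f₁ = f ∘ (inside ∷_)

  -- If no set containing the first element has colour `c`, then each `outside ∷ X` of colour `c`
  -- makes `inside ∷ X` bichromatic: the lower covers `inside ∷ Z` have the other colour.
  one-sided : ∀ c → ¬ Attains i f₁ c → n ∸ i ≤ ∑ h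
  one-sided c ¬att₁ = from-lower (att c)
    where
    h₁-pos : ∀ X → ∣ X ∣ ≡ suc i → f₀ X ≡ c → 1 ≤ h (inside ∷ X)
    h₁-pos X ∣X∣ f₀X with Z , Z⋖X ← ∃⋖ X (λ e → case trans (sym e) ∣X∣ of λ ()) =
      pos add (keep Z⋖X) ∣X∣ λ e → ¬att₁
        (Z , suc-injective (trans (sym (⋖⇒∣∣ Z⋖X)) ∣X∣) , trans (sym e) f₀X)

    from-lower : Attains (suc i) f c → n ∸ i ≤ ∑ h
    from-lower (inside ∷ X , ∣X∣ , f₁X) = contradiction (X , suc-injective ∣X∣ , f₁X) ¬att₁
    from-lower (outside ∷ X , ∣X∣ , f₀X) with attains? (suc i) f₀ (not c)
    -- One bichromatic set containing the first element, together with those found by induction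
    -- among the sets omitting it.
    ... | yes att₀ = begin
      n ∸ i               ≤⟨ m≤n+m∸n (n ∸ i) 1 ⟩
      1 + (n ∸ i ∸ 1)     ≡⟨ cong suc (trans (∸-+-assoc n i 1) (cong (n ∸_) (+-comm i 1))) ⟩
      1 + (n ∸ suc i)     ≤⟨ +-mono-≤ (≤-trans (h₁-pos X ∣X∣ f₀X) (term≤∑ (h ∘ (inside ∷_)) X)) ih ⟩
      ∑ (h ∘ (inside ∷_)) + ∑ (h ∘ (outside ∷_)) ≡⟨ +-comm (∑ (h ∘ (inside ∷_))) _ ⟩
      ∑ h                 ∎
      where
      open ≤-Reasoning
      both : ∀ b → Attains (suc i) f₀ b
      both b with b ≟ᵇ c
      ... | yes refl = X , ∣X∣ , f₀X
      ... | no b≢c rewrite ¬-not b≢c = att₀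
      ih : n ∸ suc i ≤ ∑ (h ∘ (outside ∷_))
      ih = bichromatic-bound (suc i) f₀ (h ∘ (outside ∷_)) both
             λ Z⋖Y Z′⋖Y ∣Z∣ → pos (keep Z⋖Y) (keep Z′⋖Y) ∣Z∣
    -- All sets of the level that omit the first element have colour `c`, so every `X` of size
    -- `suc i` yields a bichromatic `inside ∷ X`.
    ... | no ¬att₀ = begin
      n ∸ i                      ≤⟨ card-layer-lower n i ⟩
      card (layer {n} (suc i))   ≤⟨ ∑-mono on-layer ⟩
      ∑ (h ∘ (inside ∷_))        ≤⟨ m≤n+m _ _ ⟩
      ∑ h                        ∎
      where
      open ≤-Reasoning
      on-layer : ∀ Y → ⟦ layer (suc i) Y ⟧ ≤ h (inside ∷ Y)
      on-layer Y with layer (suc i) Y in eq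
      ... | false = z≤n
      ... | true = h₁-pos Y ∣Y∣ (trans (¬-not λ e → ¬att₀ (Y , ∣Y∣ , e)) (not-involutive c))
        where ∣Y∣ = layer⇒ (suc i) Y eq

  split : Dec (Attains i f₁ true) → Dec (Attains i f₁ false) → n ∸ i ≤ ∑ h
  split (no ¬t) _ = one-sided true ¬t
  split (yes _) (no ¬u) = one-sided false ¬u
  split (yes t) (yes u) = m≤n⇒m≤o+n _ (bichromatic-bound i f₁ (h ∘ (inside ∷_))
    (λ { true → t ; false → u }) λ Z⋖Y Z′⋖Y ∣Z∣ → pos (keep Z⋖Y) (keep Z′⋖Y) (cong suc ∣Z∣))

-- Raising an antichain

bichromatic⇒dn : (f : Subset n → Bool) → ∀ {X X′ Y} → X ⋖ Y → X′ ⋖ Y → f X ≢ f X′ →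
  0 < dn (⟦_⟧ ∘ f) Y × dn (⟦_⟧ ∘ f) Y < ∣ Y ∣
bichromatic⇒dn f {X} {X′} c c′ fX≢fX′ with f X in p | f X′ in q
... | true | true = contradiction refl fX≢fX′
... | true | false = dn-> f c p , dn-< f c′ q
... | false | true = dn-> f c′ q , dn-< f c p
... | false | false = contradiction refl fX≢fX′

UpperShadowIn : (S T : Subset n → Bool) → Set
UpperShadowIn S T = ∀ {X Y} → X ⋖ Y → S X ≡ true → T Y ≡ true

-- Let `h Y` count the lower covers that `Y` in `T` lacks in `S`. Counting covers gives
-- `(n ∸ i) * card S + ∑ h ≡ suc i * card T`, where `n ∸ i` is at least `2 + i`. The left side
-- exceeds `suc i * suc (card S)`: either `S` misses part of its level and `∑ h` supplies another
-- `n ∸ i`, or `S` is the whole level. Cancelling `suc i` from the strict inequality gives the gain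
-- of two.
shadow-growth : ∀ i (S T : Subset n → Bool) → 3 ≤ n → 2 + (i + i) ≤ n →
  (∀ {X} → S X ≡ true → ∣ X ∣ ≡ i) → UpperShadowIn S T → ∃ (λ X → S X ≡ true) →
  2 + card S ≤ card T
shadow-growth {n} i S T 3≤n 2+2i≤n S-level S↑⊆T (X₀ , SX₀) =
  *-cancelˡ-< (suc i) (suc (card S)) (card T) (subst (suc i * suc (card S) <_) double-count bound)
  where
  open ≤-Reasoning
  h : Subset n → ℕ
  h Y = suc i * ⟦ T Y ⟧ ∸ dn (⟦_⟧ ∘ S) Y

  dn≤T : ∀ Y → dn (⟦_⟧ ∘ S) Y ≤ suc i * ⟦ T Y ⟧
  dn≤T Y with dn (⟦_⟧ ∘ S) Y in eq
  ... | zero = z≤n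
  ... | suc d with X , c , SX ← dn-∃ S Y (subst (0 <_) (sym eq) z<s)
      rewrite S↑⊆T c SX | *-identityʳ i = begin
        suc d            ≡⟨ eq ⟨
        dn (⟦_⟧ ∘ S) Y   ≤⟨ dn-≤ S Y ⟩
        ∣ Y ∣            ≡⟨ ⋖⇒∣∣ c ⟩
        suc ∣ X ∣        ≡⟨ cong suc (S-level SX) ⟩
        suc i            ∎

  double-count : (n ∸ i) * card S + ∑ h ≡ suc i * card T
  double-count = begin-equality
    (n ∸ i) * card S + ∑ h
      ≡⟨ cong (_+ ∑ h) (∑-dn i S S-level) ⟨
    ∑ (dn (⟦_⟧ ∘ S)) + ∑ h
      ≡⟨ ∑-+ (dn (⟦_⟧ ∘ S)) h ⟨
    ∑ (λ Y → dn (⟦_⟧ ∘ S) Y + h Y)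
      ≡⟨ ∑-cong (λ Y → m+[n∸m]≡n (dn≤T Y)) ⟩
    ∑ (λ Y → suc i * ⟦ T Y ⟧)
      ≡⟨ ∑-*ˡ (suc i) (⟦_⟧ ∘ T) ⟩
    suc i * card T ∎

  2+i≤n∸i : 2 + i ≤ n ∸ i
  2+i≤n∸i = m+n≤o⇒m≤o∸n (2 + i) 2+2i≤n

  0<card-S : 0 < card S
  0<card-S = ≤-trans (subst (λ b → 0 < ⟦ b ⟧) (sym SX₀) z<s) (term≤∑ (⟦_⟧ ∘ S) X₀)

  full-level : ∀ j → i ≡ j → ¬ Attains i S false → suc i * suc (card S) < (n ∸ i) * card S
  -- Here `3 ≤ n` is essential: on two points the shadow of the empty set gains only one set.
  full-level zero refl ¬att = begin-strict
    suc (card S) + 0 ≡⟨ +-identityʳ _ ⟩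
    1 + card S       ≤⟨ +-mono-≤ 0<card-S ≤-refl ⟩
    card S + card S  <⟨ m<n+m _ 0<card-S ⟩
    card S + (card S + card S) ≡⟨ cong (λ s → card S + (card S + s)) (+-identityʳ (card S)) ⟨
    3 * card S       ≤⟨ *-monoˡ-≤ (card S) 3≤n ⟩
    n * card S       ∎
  -- A whole level above level 0 has more than `suc i` sets, so one extra `card S` outweighs
  -- `suc i`.
  full-level (suc j) refl ¬att = begin-strict
    suc i * suc (card S)      ≡⟨ *-suc (suc i) (card S) ⟩
    suc i + suc i * card S    <⟨ +-monoˡ-< _ large ⟩
    card S + suc i * card S   ≡⟨⟩
    (2 + i) * card S          ≤⟨ *-monoˡ-≤ (card S) 2+i≤n∸i ⟩
    (n ∸ i) * card S          ∎
    where
    layer≤S : ∀ X → ⟦ layer i X ⟧ ≤ ⟦ S X ⟧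
    layer≤S X with layer i X in eq
    ... | false = z≤n
    ... | true = ≤-reflexive (cong ⟦_⟧ (sym (¬-not λ SX → ¬att (X , layer⇒ i X eq , SX))))
    large : suc i < card S
    large = begin
      2 + i                ≤⟨ 2+i≤n∸i ⟩
      n ∸ i                ≤⟨ ∸-monoʳ-≤ n (n≤1+n j) ⟩
      n ∸ j                ≤⟨ card-layer-lower n j ⟩
      card (layer {n} i)   ≤⟨ ∑-mono layer≤S ⟩
      card S               ∎

  h-pos : ∀ {X X′ Y} → X ⋖ Y → X′ ⋖ Y → ∣ X ∣ ≡ i → S X ≢ S X′ → 1 ≤ h Y
  h-pos {X} {X′} {Y} c c′ ∣X∣ SX≢SX′ with 0<d , d<∣Y∣ ← bichromatic⇒dn S c c′ SX≢SX′
    with Z , Z⋖Y , SZ ← dn-∃ S Y 0<d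
    rewrite S↑⊆T Z⋖Y SZ | *-identityʳ i = m<n⇒0<n∸m (subst (dn (⟦_⟧ ∘ S) Y <_)
      (trans (⋖⇒∣∣ c) (cong suc ∣X∣)) d<∣Y∣)

  bound : suc i * suc (card S) < (n ∸ i) * card S + ∑ h
  bound with attains? i S false
  ... | no ¬att = ≤-trans (full-level i refl ¬att) (m≤m+n _ _)
  ... | yes att = begin-strict
    suc i * suc (card S)        <⟨ *-monoˡ-< (suc (card S)) (n<1+n (suc i)) ⟩
    (2 + i) * suc (card S)      ≤⟨ *-monoˡ-≤ (suc (card S)) 2+i≤n∸i ⟩
    (n ∸ i) * suc (card S)      ≡⟨ *-suc (n ∸ i) (card S) ⟩
    (n ∸ i) + (n ∸ i) * card S  ≡⟨ +-comm (n ∸ i) _ ⟩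
    (n ∸ i) * card S + (n ∸ i)  ≤⟨ +-monoʳ-≤ _ (bichromatic-bound i S h both h-pos) ⟩
    (n ∸ i) * card S + ∑ h      ∎
    where
    both : ∀ b → Attains i S b
    both true = X₀ , S-level SX₀ , SX₀
    both false = att

Antichain : (Subset n → Bool) → Set
Antichain f = ∀ {X Y} → f X ≡ true → f Y ≡ true → X ⊆ Y → X ≡ Y

⊆∧∣∣⇒≡ : {X Y : Subset n} → X ⊆ Y → ∣ Y ∣ ≤ ∣ X ∣ → X ≡ Y
⊆∧∣∣⇒≡ {X = []} {[]} _ _ = refl
⊆∧∣∣⇒≡ {X = outside ∷ X} {outside ∷ Y} X⊆Y ∣Y∣≤∣X∣ = cong (outside ∷_) (⊆∧∣∣⇒≡ (drop-∷-⊆ X⊆Y) ∣Y∣≤∣X∣)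
⊆∧∣∣⇒≡ {X = outside ∷ X} {inside ∷ Y} X⊆Y ∣Y∣≤∣X∣ =
  contradiction (p⊆q⇒∣p∣≤∣q∣ (drop-∷-⊆ X⊆Y)) (<⇒≱ ∣Y∣≤∣X∣)
⊆∧∣∣⇒≡ {X = inside ∷ X} {outside ∷ Y} X⊆Y _ = case X⊆Y here of λ ()
⊆∧∣∣⇒≡ {X = inside ∷ X} {inside ∷ Y} X⊆Y (s≤s ∣Y∣≤∣X∣) = cong (inside ∷_) (⊆∧∣∣⇒≡ (drop-∷-⊆ X⊆Y) ∣Y∣≤∣X∣)

∧-intro : ∀ {x y} → x ≡ true → y ≡ true → x ∧ y ≡ true
∧-intro refl refl = refl

∨-elim : ∀ x y → x ∨ y ≡ true → x ≡ true ⊎ y ≡ true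
∨-elim true y _ = inj₁ refl
∨-elim false y e = inj₂ e

∨-introʳ : ∀ x {y} → y ≡ true → x ∨ y ≡ true
∨-introʳ true _ = refl
∨-introʳ false e = e

-- `above` transports cross-intersection to the raised family, `unchanged` pulls members above level
-- `k` back to `f`, and `gain` is the strictness that excludes low members from near-optimal
-- families.
record Raising (k : ℕ) (f : Subset n → Bool) : Set where
  field
    raised     : Subset n → Bool
    antichain  : Antichain raised
    level≥     : ∀ {Y} → raised Y ≡ true → k ≤ ∣ Y ∣
    above      : ∀ {Y} → raised Y ≡ true → ∃ λ X → f X ≡ true × X ⊆ Y
    unchanged  : ∀ {Y} → raised Y ≡ true → k < ∣ Y ∣ → f Y ≡ true
    card≤      : card f ≤ card raised
    gain       : ∀ {X} → f X ≡ true → ∣ X ∣ < k → 2 + card f ≤ card raised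

-- One step: the lowest level i is replaced by its upper shadow.
module Push {n} i (f : Subset n → Bool) (f-anti : Antichain f)
  (f≥i : ∀ {X} → f X ≡ true → i ≤ ∣ X ∣) where

  bottom rest shadow push : Subset n → Bool
  bottom X = f X ∧ layer i X
  rest X = f X ∧ not (layer i X)
  shadow Y = 0 <ᵇ dn (⟦_⟧ ∘ bottom) Y
  push X = rest X ∨ shadow X

  shadow⇐ : UpperShadowIn bottom shadow
  shadow⇐ c bX = Equivalence.to T-≡ (<⇒<ᵇ (dn-> bottom c bX))

  shadow⇒ : ∀ Y → shadow Y ≡ true → ∃ λ X → X ⋖ Y × f X ≡ true × ∣ X ∣ ≡ i
  shadow⇒ Y sY with X , c , bX ← dn-∃ bottom Y (<ᵇ⇒< _ _ (Equivalence.from T-≡ sY)) =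
    X , c , ∧-conicalˡ _ _ bX , layer⇒ i X (∧-conicalʳ (f X) _ bX)

  shadow-level : ∀ Y → shadow Y ≡ true → ∣ Y ∣ ≡ suc i
  shadow-level Y sY with X , c , _ , ∣X∣ ← shadow⇒ Y sY = trans (⋖⇒∣∣ c) (cong suc ∣X∣)

  rest-level : ∀ {X} → rest X ≡ true → i < ∣ X ∣
  rest-level {X} rX = ≤∧≢⇒< (f≥i (∧-conicalˡ _ _ rX)) λ e →
    case trans (sym (∧-conicalʳ (f X) _ rX)) (cong not (layer⇐ i X (sym e))) of λ ()

  rest⇐ : ∀ {X} → f X ≡ true → i < ∣ X ∣ → rest X ≡ true
  rest⇐ {X} fX i<∣X∣ = ∧-intro fX (cong not (¬-not λ e → <⇒≢ i<∣X∣ (sym (layer⇒ i X e))))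

  push-level : ∀ {X} → push X ≡ true → i < ∣ X ∣
  push-level {X} pX with ∨-elim (rest X) _ pX
  ... | inj₁ rX = rest-level rX
  ... | inj₂ sX = ≤-reflexive (sym (shadow-level X sX))

  push-above : ∀ {Y} → push Y ≡ true → ∃ λ X → f X ≡ true × X ⊆ Y
  push-above {Y} pY with ∨-elim (rest Y) _ pY
  ... | inj₁ rY = Y , ∧-conicalˡ _ _ rY , ⊆-refl
  ... | inj₂ sY with X , c , fX , _ ← shadow⇒ Y sY = X , fX , ⋖⇒⊆ c

  push-unchanged : ∀ {Y} → push Y ≡ true → suc i < ∣ Y ∣ → f Y ≡ true
  push-unchanged {Y} pY 1+i<∣Y∣ with ∨-elim (rest Y) _ pY
  ... | inj₁ rY = ∧-conicalˡ _ _ rY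
  ... | inj₂ sY = contradiction (sym (shadow-level Y sY)) (<⇒≢ 1+i<∣Y∣)

  -- The inclusion is in fact impossible: `X` covers a bottom member `Z` of `f`, so `Z ⊆ Y` forces
  -- `Z ≡ Y`, although `Y` lies above level `i`.
  shadow-⊈-rest : ∀ X {Y} → shadow X ≡ true → rest Y ≡ true → X ⊆ Y → X ≡ Y
  shadow-⊈-rest X sX rY X⊆Y with Z , c , fZ , ∣Z∣ ← shadow⇒ X sX
    with refl ← f-anti fZ (∧-conicalˡ _ _ rY) (⊆-trans (⋖⇒⊆ c) X⊆Y) =
    contradiction (sym ∣Z∣) (<⇒≢ (rest-level rY))

  push-antichain : Antichain push
  push-antichain {X} {Y} pX pY X⊆Y with ∨-elim (rest X) _ pX | ∨-elim (rest Y) _ pY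
  ... | inj₁ rX | inj₁ rY = f-anti (∧-conicalˡ _ _ rX) (∧-conicalˡ _ _ rY) X⊆Y
  ... | inj₁ rX | inj₂ sY = ⊆∧∣∣⇒≡ X⊆Y (subst (_≤ ∣ X ∣) (sym (shadow-level Y sY)) (rest-level rX))
  ... | inj₂ sX | inj₁ rY = shadow-⊈-rest X sX rY X⊆Y
  ... | inj₂ sX | inj₂ sY = ⊆∧∣∣⇒≡ X⊆Y (≤-reflexive (trans (shadow-level Y sY) (sym (shadow-level X sX))))

  card-f : card f ≡ card bottom + card rest
  card-f = trans (∑-cong λ X → split (f X) (layer i X)) (∑-+ (⟦_⟧ ∘ bottom) (⟦_⟧ ∘ rest))
    where
    split : ∀ x y → ⟦ x ⟧ ≡ ⟦ x ∧ y ⟧ + ⟦ x ∧ not y ⟧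
    split false y = refl
    split true false = refl
    split true true = refl

  card-push : card push ≡ card shadow + card rest
  card-push = trans (∑-cong disjoint) (∑-+ (⟦_⟧ ∘ shadow) (⟦_⟧ ∘ rest))
    where
    disjoint : ∀ X → ⟦ push X ⟧ ≡ ⟦ shadow X ⟧ + ⟦ rest X ⟧
    disjoint X with rest X in r | shadow X in s
    ... | false | true = refl
    ... | false | false = refl
    ... | true | false = refl
    ... | true | true with Z , c , fZ , ∣Z∣ ← shadow⇒ X s with refl ← f-anti fZ (∧-conicalˡ _ _ r) (⋖⇒⊆ c) =
      contradiction (sym ∣Z∣) (<⇒≢ (rest-level r))

  module _ (3≤n : 3 ≤ n) (2+2i≤n : 2 + (i + i) ≤ n) where

    push-gain : ∀ {X} → bottom X ≡ true → 2 + card f ≤ card push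
    push-gain bX rewrite card-f | card-push = +-monoˡ-≤ (card rest)
      (shadow-growth i bottom shadow 3≤n 2+2i≤n
        (λ {X} bX → layer⇒ i X (∧-conicalʳ (f X) _ bX)) shadow⇐ (_ , bX))

    push-card≤ : card f ≤ card push
    push-card≤ with anySubset? (λ X → bottom X ≟ᵇ true)
    ... | yes (X , bX) = ≤-trans (m≤n+m _ 2) (push-gain bX)
    ... | no ¬b = begin
      card f                    ≡⟨ card-f ⟩
      card bottom + card rest   ≤⟨ +-monoˡ-≤ (card rest) (∑-mono λ X →
                                     subst (λ b → ⟦ b ⟧ ≤ ⟦ shadow X ⟧) (sym (¬-not λ e → ¬b (X , e))) z≤n) ⟩
      card shadow + card rest   ≡⟨ card-push ⟨
      card push                 ∎
      where open ≤-Reasoning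

-- Induction on the number `d` of levels still to be cleared. Since `2(d + i) ≤ n`, every level
-- pushed on the way satisfies the size condition of `shadow-growth`.
raise-from : ∀ d i (f : Subset n → Bool) → 3 ≤ n → (d + i) + (d + i) ≤ n → Antichain f →
  (∀ {X} → f X ≡ true → i ≤ ∣ X ∣) → Raising (d + i) f
raise-from zero i f _ _ f-anti f≥i = record
  { raised = f
  ; antichain = f-anti
  ; level≥ = f≥i
  ; above = λ {Y} fY → Y , fY , ⊆-refl
  ; unchanged = λ fY _ → fY
  ; card≤ = ≤-refl
  ; gain = λ fX ∣X∣<i → contradiction (f≥i fX) (<⇒≱ ∣X∣<i)
  }
raise-from {n} (suc d) i f 3≤n 2k≤n f-anti f≥i = record
  { raised = R.raised
  ; antichain = R.antichain
  ; level≥ = λ {Y} rY → subst (_≤ ∣ Y ∣) (+-suc d i) (R.level≥ rY)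
  ; above = above
  ; unchanged = λ {Y} rY k<∣Y∣ → P.push-unchanged
      (R.unchanged rY (subst (_< ∣ Y ∣) (sym (+-suc d i)) k<∣Y∣))
      (≤-trans (s≤s (s≤s (m≤n+m i d))) k<∣Y∣)
  ; card≤ = ≤-trans (P.push-card≤ 3≤n 2+2i≤n) R.card≤
  ; gain = gain
  }
  where
  module P = Push i f f-anti f≥i
  2+2i≤n : 2 + (i + i) ≤ n
  2+2i≤n = begin
    2 + (i + i)                     ≡⟨ cong suc (+-suc i i) ⟨
    suc i + suc i                   ≤⟨ +-mono-≤ (s≤s (m≤n+m i d)) (s≤s (m≤n+m i d)) ⟩
    (suc d + i) + (suc d + i)       ≤⟨ 2k≤n ⟩
    n                               ∎
    where open ≤-Reasoning
  R : Raising (d + suc i) P.push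
  R = raise-from d (suc i) P.push 3≤n (subst (λ k → k + k ≤ n) (sym (+-suc d i)) 2k≤n) P.push-antichain P.push-level
  module R = Raising R
  above : ∀ {Y} → R.raised Y ≡ true → ∃ λ X → f X ≡ true × X ⊆ Y
  above rY with X , pX , X⊆Y ← R.above rY with Z , fZ , Z⊆X ← P.push-above pX =
    Z , fZ , ⊆-trans Z⊆X X⊆Y
  gain : ∀ {X} → f X ≡ true → ∣ X ∣ < suc d + i → 2 + card f ≤ card R.raised
  -- A member above level `i` survives this push and produces its gain later; a member on level `i`
  -- produces it now.
  gain {X} fX ∣X∣<k with i <? ∣ X ∣
  ... | yes i<∣X∣ = ≤-trans (+-monoʳ-≤ 2 (P.push-card≤ 3≤n 2+2i≤n))
          (R.gain (cong (_∨ P.shadow X) (P.rest⇐ fX i<∣X∣)) (subst (∣ X ∣ <_) (sym (+-suc d i)) ∣X∣<k))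
  ... | no i≮∣X∣ = ≤-trans (P.push-gain 3≤n 2+2i≤n
          (∧-intro fX (layer⇐ i X (≤-antisym (≮⇒≥ i≮∣X∣) (f≥i fX))))) R.card≤

raise : ∀ k (f : Subset n → Bool) → 3 ≤ n → k + k ≤ n → Antichain f → Raising k f
raise {n} k f 3≤n 2k≤n f-anti = subst (λ k → Raising k f) (+-identityʳ k)
  (raise-from k 0 f 3≤n (subst (λ k → k + k ≤ n) (sym (+-identityʳ k)) 2k≤n) f-anti (λ _ → z≤n))

-- Pairs of antichains on two consecutive levels

∁-involutive : (X : Subset n) → ∁ (∁ X) ≡ X
∁-involutive [] = refl
∁-involutive (x ∷ X) = cong₂ _∷_ (not-involutive x) (∁-involutive X)

n∸[n/2] : ∀ {m} → n ≡ m + m → n ∸ m ≡ m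
n∸[n/2] {m = m} n≡ = trans (cong (_∸ m) n≡) (m+n∸m≡n m m)

n∸[n/2-1] : ∀ {m} → n ≡ suc m + suc m → n ∸ m ≡ 2 + m
n∸[n/2-1] {m = m} n≡ = trans (cong (_∸ m) (trans n≡ shift)) (m+n∸m≡n m (2 + m))
  where
  shift : suc m + suc m ≡ m + (2 + m)
  shift = sym (+-suc m (suc m))

∣∁X∣ : ∀ {m} → n ≡ m + m → (X : Subset n) → ∣ X ∣ ≡ m → ∣ ∁ X ∣ ≡ m
∣∁X∣ {m = m} n≡ X ∣X∣ = trans (∣∁p∣≡n∸∣p∣ X) (trans (cong (_ ∸_) ∣X∣) (n∸[n/2] n≡))

on-layer : ℕ → (Subset n → Bool) → Subset n → Bool
on-layer k f X = f X ∧ layer k X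

-- Stated for the complements of the two families: disjoint A and B on the middle
-- level are complementary, so their complements are X and ∁ X.
record TwoLayerPair (m : ℕ) (a b : Subset n → Bool) : Set where
  field
    a-antichain : Antichain a
    b-antichain : Antichain b
    a-level     : ∀ {X} → a X ≡ true → ∣ X ∣ ≡ m ⊎ ∣ X ∣ ≡ suc m
    b-level     : ∀ {X} → b X ≡ true → ∣ X ∣ ≡ m ⊎ ∣ X ∣ ≡ suc m
    cross       : ∀ {X} → ∣ X ∣ ≡ suc m → a X ≡ true → b (∁ X) ≢ true

swap-pair : ∀ {m} {a b : Subset n → Bool} → n ≡ suc m + suc m → TwoLayerPair m a b → TwoLayerPair m b a
swap-pair {b = b} n≡ P = record
  { a-antichain = P.b-antichain
  ; b-antichain = P.a-antichain
  ; a-level = P.b-level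
  ; b-level = P.a-level
  ; cross = λ {X} ∣X∣ bX a∁X → P.cross (∣∁X∣ n≡ X ∣X∣) a∁X (trans (cong b (∁-involutive X)) bX)
  }
  where module P = TwoLayerPair P

module OneFamily {n} (m : ℕ) (a : Subset n → Bool) (a-antichain : Antichain a)
  (a-level : ∀ {X} → a X ≡ true → ∣ X ∣ ≡ m ⊎ ∣ X ∣ ≡ suc m) where

  low top : Subset n → Bool
  low = on-layer m a
  top = on-layer (suc m) a

  deg : Subset n → ℕ
  deg = dn (⟦_⟧ ∘ low)

  low-level : ∀ {X} → low X ≡ true → ∣ X ∣ ≡ m
  low-level {X} lX = layer⇒ m X (∧-conicalʳ (a X) _ lX)

  top-level : ∀ {X} → top X ≡ true → ∣ X ∣ ≡ suc m
  top-level {X} tX = layer⇒ (suc m) X (∧-conicalʳ (a X) _ tX)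

  low≤layer : ∀ X → ⟦ low X ⟧ ≤ ⟦ layer m X ⟧
  low≤layer X with a X
  ... | true = ≤-refl
  ... | false = z≤n

  deg≤ : ∀ X → deg X ≤ suc m * ⟦ layer (suc m) X ⟧
  deg≤ X = ≤-trans (dn-mono low≤layer X) (≤-reflexive (dn-layer m X))

  top⇒deg≡0 : ∀ X → top X ≡ true → deg X ≡ 0
  top⇒deg≡0 X tX with deg X in eq
  ... | zero = refl
  ... | suc d with Z , Z⋖X , lZ ← dn-∃ low X (subst (0 <_) (sym eq) z<s)
    with refl ← a-antichain (∧-conicalˡ _ _ lZ) (∧-conicalˡ _ _ tX) (⋖⇒⊆ Z⋖X) =
    contradiction (⋖⇒∣∣ Z⋖X) (<⇒≢ (n<1+n _))

  deg>0⇒¬top : ∀ X → 0 < deg X → top X ≡ false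
  deg>0⇒¬top X 0<d = ¬-not λ tX → <⇒≢ 0<d (sym (top⇒deg≡0 X tX))

  card-split : card a ≡ card low + card top
  card-split = trans (∑-cong pointwise) (∑-+ (⟦_⟧ ∘ low) (⟦_⟧ ∘ top))
    where
    pointwise : ∀ X → ⟦ a X ⟧ ≡ ⟦ low X ⟧ + ⟦ top X ⟧
    pointwise X with a X in eq
    ... | false = refl
    ... | true with a-level eq
    ...   | inj₁ ∣X∣ rewrite layer⇐ m X ∣X∣
            | ¬-not (λ e → 1+n≢n (trans (sym (layer⇒ (suc m) X e)) ∣X∣)) = refl
    ...   | inj₂ ∣X∣ rewrite layer⇐ (suc m) X ∣X∣
            | ¬-not (λ e → 1+n≢n (trans (sym ∣X∣) (layer⇒ m X e))) = refl

  -- `proper` is the hypothesis of `bichromatic-bound` for the colouring of level `m` by `low`; the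
  -- other two cases are the constant colourings.
  data Shape : Set where
    empty  : (∀ X → low X ≡ false) → Shape
    full   : (∀ X → ∣ X ∣ ≡ m → low X ≡ true) → Shape
    proper : (∀ b → Attains m low b) → Shape

  shape : Shape
  shape with attains? m low true | attains? m low false
  ... | no ¬t | _ = empty λ X → ¬-not λ lX → ¬t (X , low-level lX , lX)
  ... | yes _ | no ¬u = full λ X ∣X∣ → ¬-not λ lX → ¬u (X , ∣X∣ , lX)
  ... | yes t | yes u = proper λ { true → t ; false → u }

  card-full : (∀ X → ∣ X ∣ ≡ m → low X ≡ true) → card low ≡ card (layer {n} m)
  card-full low-full = ∑-cong pointwise
    where
    pointwise : ∀ X → ⟦ low X ⟧ ≡ ⟦ layer m X ⟧
    pointwise X with layer m X in eq
    ... | true = cong (λ b → ⟦ b ∧ true ⟧) (∧-conicalˡ _ _ (low-full X (layer⇒ m X eq)))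
    ... | false with a X
    ...   | true = refl
    ...   | false = refl

  card-empty : (∀ X → low X ≡ false) → card low ≡ 0
  card-empty low-empty = trans (∑-cong λ X → cong ⟦_⟧ (low-empty X)) (∑-0 n)

  deg-empty : (∀ X → low X ≡ false) → ∀ X → deg X ≡ 0
  deg-empty low-empty X = n≤0⇒n≡0 (≤-trans (dn-mono (λ Y → ≤-reflexive (cong ⟦_⟧ (low-empty Y))) X)
    (≤-reflexive (dn-0 X)))

  full⇒¬top : (∀ X → ∣ X ∣ ≡ m → low X ≡ true) → ∀ X → top X ≡ false
  full⇒¬top low-full X = ¬-not no-top
    where
    no-top : top X ≢ true
    no-top tX with Z , c ← ∃⋖ X (λ e → 1+n≢0 (trans (sym (top-level tX)) e)) =
      <⇒≢ (dn-> low c (low-full Z (suc-injective (trans (sym (⋖⇒∣∣ c)) (top-level tX)))))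
          (sym (top⇒deg≡0 X tX))

  ¬top⇒level : (∀ X → top X ≡ false) → ∀ {X} → a X ≡ true → ∣ X ∣ ≡ m
  ¬top⇒level ¬top {X} aX with a-level aX
  ... | inj₁ ∣X∣ = ∣X∣
  ... | inj₂ ∣X∣ = case trans (sym (¬top X)) (∧-intro aX (layer⇐ (suc m) X ∣X∣)) of λ ()

  ¬low⇒level : (∀ X → low X ≡ false) → ∀ {X} → a X ≡ true → ∣ X ∣ ≡ suc m
  ¬low⇒level ¬low {X} aX with a-level aX
  ... | inj₂ ∣X∣ = ∣X∣
  ... | inj₁ ∣X∣ = case trans (sym (¬low X)) (∧-intro aX (layer⇐ m X ∣X∣)) of λ ()

  card-low : (∀ X → top X ≡ false) → card a ≡ card low
  card-low ¬top = trans card-split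
    (trans (cong (card low +_) (trans (∑-cong λ X → cong ⟦_⟧ (¬top X)) (∑-0 n))) (+-identityʳ _))

-- These describe complemented families with `n = 2(m + 1)`: level `m` stands for the original level
-- `n / 2 + 1`, and level `suc m` for `n / 2`. The name tells which of the two levels misses one
-- set.
LowerDefect UpperDefect : (m : ℕ) (a b : Subset n → Bool) → Set
LowerDefect {n} m a b =
  (∀ {X} → a X ≡ true → ∣ X ∣ ≡ m) × suc (card a) ≡ card (layer {n} m) ×
  (∀ {X} → b X ≡ true → ∣ X ∣ ≡ suc m) × (∀ {X} → ∣ X ∣ ≡ suc m → b X ≡ true)
UpperDefect {n} m a b =
  (∀ {X} → a X ≡ true → ∣ X ∣ ≡ m) × (∀ {X} → ∣ X ∣ ≡ m → a X ≡ true) ×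
  (∀ {X} → b X ≡ true → ∣ X ∣ ≡ suc m) × suc (card b) ≡ card (layer {n} (suc m))

module Middle {n m} (n≡ : n ≡ suc m + suc m) {a b : Subset n → Bool} (P : TwoLayerPair m a b) where
  open TwoLayerPair P
  module A = OneFamily m a a-antichain a-level
  module B = OneFamily m b b-antichain b-level

  M N r s : ℕ
  M = card (layer {n} (suc m))
  N = card (layer {n} m)
  r = card A.low
  s = card B.low

  L p g slack : Subset n → ℕ
  L X = ⟦ layer (suc m) X ⟧
  p X = ⟦ A.top X ⟧ + ⟦ B.top (∁ X) ⟧
  g X = A.deg X + B.deg (∁ X) + suc m * p X
  slack X = (suc m + suc m) * L X ∸ g X

  n∸m : n ∸ m ≡ suc (suc m)
  n∸m = n∸[n/2-1] n≡

  L-∁ : ∀ X → L (∁ X) ≡ L X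
  L-∁ X with layer (suc m) X in eq
  ... | true rewrite layer⇐ (suc m) (∁ X) (∣∁X∣ n≡ X (layer⇒ (suc m) X eq)) = refl
  ... | false = cong ⟦_⟧ (¬-not λ e → case trans (sym eq) (layer⇐ (suc m) X
      (trans (cong ∣_∣ (sym (∁-involutive X))) (∣∁X∣ n≡ (∁ X) (layer⇒ (suc m) (∁ X) e)))) of λ ())

  degA≤ : ∀ X → A.deg X ≤ suc m * L X
  degA≤ = A.deg≤

  degB≤ : ∀ X → B.deg (∁ X) ≤ suc m * L X
  degB≤ X = subst (λ l → B.deg (∁ X) ≤ suc m * l) (L-∁ X) (B.deg≤ (∁ X))

  topA⇒L : ∀ X → A.top X ≡ true → L X ≡ 1
  topA⇒L X tX = cong ⟦_⟧ (∧-conicalʳ (a X) _ tX)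

  topB⇒L : ∀ X → B.top (∁ X) ≡ true → L X ≡ 1
  topB⇒L X tX = trans (sym (L-∁ X)) (cong ⟦_⟧ (∧-conicalʳ (b (∁ X)) _ tX))

  top-exclusive : ∀ X → A.top X ≡ true → B.top (∁ X) ≢ true
  top-exclusive X tX t∁X = cross (A.top-level tX) (∧-conicalˡ _ _ tX) (∧-conicalˡ _ _ t∁X)

  p≤L : ∀ X → p X ≤ L X
  p≤L X with A.top X in tA | B.top (∁ X) in tB
  ... | true | true = contradiction tB (top-exclusive X tA)
  ... | true | false = ≤-reflexive (sym (topA⇒L X tA))
  ... | false | true = ≤-reflexive (sym (topB⇒L X tB))
  ... | false | false = z≤n

  -- A family with a top member at the set in question has degree 0 there, so the `suc m` counted
  -- through `p` replaces its degree instead of adding to it.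
  g≤ : ∀ X → g X ≤ (suc m + suc m) * L X
  g≤ X = subst (g X ≤_) (sym (*-distribʳ-+ (L X) (suc m) (suc m))) bound
    where
    open ≤-Reasoning
    bound : g X ≤ suc m * L X + suc m * L X
    bound with A.top X in tA | B.top (∁ X) in tB
    ... | true | true = contradiction tB (top-exclusive X tA)
    ... | true | false rewrite A.top⇒deg≡0 X tA =
      +-mono-≤ (degB≤ X) (≤-reflexive (cong (suc m *_) (sym (topA⇒L X tA))))
    ... | false | true rewrite B.top⇒deg≡0 (∁ X) tB | +-identityʳ (A.deg X) =
      +-mono-≤ (degA≤ X) (≤-reflexive (cong (suc m *_) (sym (topB⇒L X tB))))
    ... | false | false rewrite *-zeroʳ m | +-identityʳ (A.deg X + B.deg (∁ X)) = +-mono-≤ (degA≤ X) (degB≤ X)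

  ∑-p : ∑ p ≡ card A.top + card B.top
  ∑-p = trans (∑-+ (⟦_⟧ ∘ A.top) (⟦_⟧ ∘ B.top ∘ ∁)) (cong (card A.top +_) (∑-∁ (⟦_⟧ ∘ B.top)))

  ∑-g : ∑ g ≡ suc (suc m) * (r + s) + suc m * ∑ p
  ∑-g = begin
    ∑ g
      ≡⟨ ∑-+ (λ X → A.deg X + B.deg (∁ X)) (λ X → suc m * p X) ⟩
    ∑ (λ X → A.deg X + B.deg (∁ X)) + ∑ (λ X → suc m * p X)
      ≡⟨ cong₂ _+_ (∑-+ A.deg (B.deg ∘ ∁)) (∑-*ˡ (suc m) p) ⟩
    ∑ A.deg + ∑ (B.deg ∘ ∁) + suc m * ∑ p
      ≡⟨ cong (_+ suc m * ∑ p) (cong₂ _+_ (∑-dn m A.low A.low-level)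
           (trans (∑-∁ B.deg) (∑-dn m B.low B.low-level))) ⟩
    (n ∸ m) * r + (n ∸ m) * s + suc m * ∑ p
      ≡⟨ cong (_+ suc m * ∑ p) (*-distribˡ-+ (n ∸ m) r s) ⟨
    (n ∸ m) * (r + s) + suc m * ∑ p
      ≡⟨ cong (λ k → k * (r + s) + suc m * ∑ p) n∸m ⟩
    suc (suc m) * (r + s) + suc m * ∑ p ∎
    where open ≡-Reasoning

  layer-ratio : suc (suc m) * N ≡ suc m * M
  layer-ratio = begin
    suc (suc m) * N                ≡⟨ cong (_* N) n∸m ⟨
    (n ∸ m) * N                    ≡⟨ ∑-dn m (layer m) (λ {X} → layer⇒ m X) ⟨
    ∑ (dn (⟦_⟧ ∘ layer {n} m))     ≡⟨ ∑-cong {n} (dn-layer m) ⟩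
    ∑ (λ Y → suc m * L Y)          ≡⟨ ∑-*ˡ (suc m) L ⟩
    suc m * M                      ∎
    where open ≡-Reasoning

  card-total : card a + card b ≡ (r + s) + ∑ p
  card-total rewrite A.card-split | B.card-split | ∑-p = +-interchange r (card A.top) s (card B.top)

  ∑p≤M : ∑ p ≤ M
  ∑p≤M = ∑-mono p≤L

  -- Sum of `g X + slack X` over all `X`, with half of the resulting `2(m + 1)M` traded for a
  -- multiple of `N` by `layer-ratio`. As an exact identity it bounds the total and also controls
  -- near-equality.
  balance : suc m * (card a + card b) + (r + s) + ∑ slack ≡ suc m * (M + N) + N
  balance = begin
    suc m * (card a + card b) + (r + s) + ∑ slack
      ≡⟨ cong (λ t → suc m * t + (r + s) + ∑ slack) card-total ⟩
    suc m * ((r + s) + ∑ p) + (r + s) + ∑ slack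
      ≡⟨ regroup (r + s) (∑ p) (∑ slack) m ⟩
    suc (suc m) * (r + s) + suc m * ∑ p + ∑ slack
      ≡⟨ cong (_+ ∑ slack) ∑-g ⟨
    ∑ g + ∑ slack
      ≡⟨ ∑-+ g slack ⟨
    ∑ (λ X → g X + slack X)
      ≡⟨ ∑-cong (λ X → m+[n∸m]≡n (g≤ X)) ⟩
    ∑ (λ X → (suc m + suc m) * L X)
      ≡⟨ ∑-*ˡ (suc m + suc m) L ⟩
    (suc m + suc m) * M
      ≡⟨ *-distribʳ-+ M (suc m) (suc m) ⟩
    suc m * M + suc m * M
      ≡⟨ cong (suc m * M +_) layer-ratio ⟨
    suc m * M + suc (suc m) * N
      ≡⟨ regroup′ m M N ⟩
    suc m * (M + N) + N ∎
    where
    open ≡-Reasoning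
    regroup : ∀ x p σ m → suc m * (x + p) + x + σ ≡ suc (suc m) * x + suc m * p + σ
    regroup = solve-∀
    regroup′ : ∀ m M N → suc m * M + suc (suc m) * N ≡ suc m * (M + N) + N
    regroup′ = solve-∀

  -- If the total were larger, `∑ p ≤ M` would force `r + s` above `N`, while `balance` keeps it at
  -- most `N`.
  total≤ : card a + card b ≤ M + N
  total≤ = ≮⇒≥ λ M+N<T → <-irrefl refl (begin-strict
    N             <⟨ +-cancelʳ-< M N (r + s) (begin-strict
      N + M            ≡⟨ +-comm N M ⟩
      M + N            <⟨ M+N<T ⟩
      card a + card b  ≡⟨ card-total ⟩
      (r + s) + ∑ p    ≤⟨ +-monoʳ-≤ (r + s) ∑p≤M ⟩
      (r + s) + M      ∎) ⟩
    r + s         ≤⟨ +-cancelˡ-≤ (suc m * (M + N)) (r + s) N (begin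
      suc m * (M + N) + (r + s)                       ≤⟨ +-monoˡ-≤ (r + s) (*-monoʳ-≤ (suc m) (<⇒≤ M+N<T)) ⟩
      suc m * (card a + card b) + (r + s)             ≤⟨ m≤m+n _ _ ⟩
      suc m * (card a + card b) + (r + s) + ∑ slack   ≡⟨ balance ⟩
      suc m * (M + N) + N                             ∎) ⟩
    N             ∎)
    where open ≤-Reasoning

  -- The degree of `Y` in `a` is positive, so `Y` is not a top member, yet it is below `suc m`; the
  -- share of `a` in `g Y` therefore falls short.
  bichromatic-slack : ∀ {X X′ Y} → X ⋖ Y → X′ ⋖ Y → ∣ X ∣ ≡ m → A.low X ≢ A.low X′ → 1 ≤ slack Y
  bichromatic-slack {X} {X′} {Y} c c′ ∣X∣ ≢low
    with 0<d , d<∣Y∣ ← bichromatic⇒dn A.low c c′ ≢low = m<n⇒0<n∸m (subst (g Y <_)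
      (sym (trans (cong ((suc m + suc m) *_) LY) (*-identityʳ _))) bound)
    where
    ∣Y∣ : ∣ Y ∣ ≡ suc m
    ∣Y∣ = trans (⋖⇒∣∣ c) (cong suc ∣X∣)
    LY : L Y ≡ 1
    LY = cong ⟦_⟧ (layer⇐ (suc m) Y ∣Y∣)
    degB≤m : B.deg (∁ Y) ≤ suc m
    degB≤m = subst (B.deg (∁ Y) ≤_) (trans (cong (suc m *_) LY) (*-identityʳ (suc m))) (degB≤ Y)
    bound : g Y < suc m + suc m
    bound rewrite A.deg>0⇒¬top Y 0<d with B.top (∁ Y) in tB
    ... | true rewrite B.top⇒deg≡0 (∁ Y) tB | +-identityʳ (A.deg Y) | *-identityʳ m =
      +-monoˡ-< (suc m) (subst (A.deg Y <_) ∣Y∣ d<∣Y∣)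
    ... | false rewrite *-zeroʳ m | +-identityʳ (A.deg Y + B.deg (∁ Y)) =
      +-mono-<-≤ (subst (A.deg Y <_) ∣Y∣ d<∣Y∣) degB≤m

  module NearOptimal (total : suc (card a + card b) ≡ M + N) where

    slack+low : ∑ slack + (r + s) ≡ suc m + N
    slack+low = +-cancelˡ-≡ (suc m * (card a + card b)) _ _ (begin
      suc m * T + (∑ slack + (r + s))   ≡⟨ regroup (suc m * T) (∑ slack) (r + s) ⟩
      suc m * T + (r + s) + ∑ slack     ≡⟨ balance ⟩
      suc m * (M + N) + N               ≡⟨ cong (λ t → suc m * t + N) total ⟨
      suc m * suc T + N                 ≡⟨ cong (_+ N) (*-suc (suc m) T) ⟩
      suc m + suc m * T + N             ≡⟨ regroup′ (suc m) (suc m * T) N ⟩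
      suc m * T + (suc m + N)           ∎)
      where
      open ≡-Reasoning
      T : ℕ
      T = card a + card b
      regroup : ∀ t σ x → t + (σ + x) ≡ t + x + σ
      regroup = solve-∀
      regroup′ : ∀ k t N → k + t + N ≡ t + (k + N)
      regroup′ = solve-∀

    N≤1+low : N ≤ suc (r + s)
    N≤1+low = +-cancelʳ-≤ M N (suc (r + s)) (begin
      N + M                    ≡⟨ +-comm N M ⟩
      M + N                    ≡⟨ total ⟨
      suc (card a + card b)    ≡⟨ cong suc card-total ⟩
      suc (r + s) + ∑ p        ≤⟨ +-monoʳ-≤ (suc (r + s)) ∑p≤M ⟩
      suc (r + s) + M          ∎)
      where open ≤-Reasoning

    -- Bichromatic sets force slack at least `m + 2`, hence `suc (r + s) ≤ N`; with `N≤1+low` this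
    -- is an equality. So `∑ p` equals `M`, the slack is exactly `m + 2`, and every estimate is
    -- tight.
    module ProperA (A-proper : ∀ c → Attains m A.low c) where

      2+m≤slack : suc (suc m) ≤ ∑ slack
      2+m≤slack = subst (_≤ ∑ slack) n∸m (bichromatic-bound m A.low slack A-proper bichromatic-slack)

      1+low≤N : suc (r + s) ≤ N
      1+low≤N = +-cancelˡ-≤ (suc m) (suc (r + s)) N (begin
        suc m + suc (r + s)      ≡⟨ +-suc (suc m) (r + s) ⟩
        suc (suc m) + (r + s)    ≤⟨ +-monoˡ-≤ (r + s) 2+m≤slack ⟩
        ∑ slack + (r + s)        ≡⟨ slack+low ⟩
        suc m + N                ∎)
        where open ≤-Reasoning

      1+low≡N : suc (r + s) ≡ N
      1+low≡N = ≤-antisym 1+low≤N N≤1+low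

      L≤p : ∀ X → L X ≤ p X
      L≤p = ∑-≤-rigid p≤L (+-cancelˡ-≤ (suc (r + s)) M (∑ p) (begin
        suc (r + s) + M         ≡⟨ cong (_+ M) 1+low≡N ⟩
        N + M                   ≡⟨ +-comm N M ⟩
        M + N                   ≡⟨ total ⟨
        suc (card a + card b)   ≡⟨ cong suc card-total ⟩
        suc (r + s) + ∑ p       ∎))
        where open ≤-Reasoning

      ¬topA⇒topB : ∀ X → ∣ X ∣ ≡ suc m → A.top X ≡ false → B.top (∁ X) ≡ true
      ¬topA⇒topB X ∣X∣ tX with L≤p X
      ... | L≤p rewrite layer⇐ (suc m) X ∣X∣ | tX with B.top (∁ X)
      ...   | true = refl
      ...   | false = case L≤p of λ ()

      -- The bichromatic sets `Y` all have `∁ Y` among the top members of `b` and already carry the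
      -- whole slack `m + 2`, so no slack is left elsewhere.
      slack≤slackB : ∀ X → slack X ≤ slack X * ⟦ B.top (∁ X) ⟧
      slack≤slackB = ∑-≤-rigid (λ X → ≤-trans (*-monoʳ-≤ (slack X) (⟦b⟧≤1 (B.top (∁ X)))) (≤-reflexive (*-identityʳ (slack X))))
        (begin
          ∑ slack                                    ≡⟨ +-cancelʳ-≡ (r + s) _ _ (trans slack+low
                                                           (trans (cong (suc m +_) (sym 1+low≡N)) (+-suc (suc m) (r + s)))) ⟩
          suc (suc m)                                ≡⟨ n∸m ⟨
          n ∸ m                                      ≤⟨ bichromatic-bound m A.low _ A-proper pos ⟩
          ∑ (λ X → slack X * ⟦ B.top (∁ X) ⟧)        ∎)
        where
        open ≤-Reasoning
        pos : ∀ {X X′ Y} → X ⋖ Y → X′ ⋖ Y → ∣ X ∣ ≡ m → A.low X ≢ A.low X′ → 1 ≤ slack Y * ⟦ B.top (∁ Y) ⟧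
        pos {Y = Y} c c′ ∣X∣ ≢low = begin
          1                              ≤⟨ bichromatic-slack c c′ ∣X∣ ≢low ⟩
          slack Y                        ≡⟨ *-identityʳ (slack Y) ⟨
          slack Y * 1                    ≡⟨ cong (λ x → slack Y * ⟦ x ⟧) topB ⟨
          slack Y * ⟦ B.top (∁ Y) ⟧      ∎
          where
          topB : B.top (∁ Y) ≡ true
          topB = ¬topA⇒topB Y (trans (⋖⇒∣∣ c) (cong suc ∣X∣))
            (A.deg>0⇒¬top Y (proj₁ (bichromatic⇒dn A.low c c′ ≢low)))

      -- Such an `X` has no slack and degree 0 in `a`, so the degree of `∁ X` in `b` must attain its
      -- maximum `suc m`.
      topA⇒degB : ∀ X → A.top X ≡ true → suc m ≤ B.deg (∁ X)
      topA⇒degB X tX = +-cancelʳ-≤ (suc m) (suc m) (B.deg (∁ X)) (begin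
        suc m + suc m            ≡⟨ *-identityʳ _ ⟨
        (suc m + suc m) * 1      ≡⟨ cong ((suc m + suc m) *_) (topA⇒L X tX) ⟨
        (suc m + suc m) * L X    ≤⟨ m∸n≡0⇒m≤n (n≤0⇒n≡0 (begin
          slack X                        ≤⟨ slack≤slackB X ⟩
          slack X * ⟦ B.top (∁ X) ⟧      ≡⟨ cong (λ b → slack X * ⟦ b ⟧) ¬tB ⟩
          slack X * 0                    ≡⟨ *-zeroʳ (slack X) ⟩
          0                              ∎)) ⟩
        g X                      ≡⟨ cong₂ (λ d q → d + B.deg (∁ X) + suc m * q) (A.top⇒deg≡0 X tX)
                                      (cong₂ (λ x y → ⟦ x ⟧ + ⟦ y ⟧) tX ¬tB) ⟩
        B.deg (∁ X) + suc m * 1  ≡⟨ cong (B.deg (∁ X) +_) (*-identityʳ (suc m)) ⟩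
        B.deg (∁ X) + suc m      ∎)
        where
        open ≤-Reasoning
        ¬tB : B.top (∁ X) ≡ false
        ¬tB = ¬-not (top-exclusive X tX)

      -- No set `Y` is bichromatic for `b`: if `∁ Y` is a top member of `a`, the degree of `Y` is
      -- full, and otherwise `Y` is a top member of `b` with degree 0. The zero weight thus meets
      -- the hypothesis of `bichromatic-bound`, contradicting its positive bound.
      B-not-proper : ¬ (∀ c → Attains m B.low c)
      B-not-proper B-proper = <⇒≱ (subst (0 <_) (sym n∸m) z<s)
        (subst (n ∸ m ≤_) (∑-0 n) (bichromatic-bound m B.low (λ _ → 0) B-proper none))
        where
        none : ∀ {X X′ Y} → X ⋖ Y → X′ ⋖ Y → ∣ X ∣ ≡ m → B.low X ≢ B.low X′ → 1 ≤ 0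
        none {Y = Y} c c′ ∣X∣ ≢low with 0<d , d<∣Y∣ ← bichromatic⇒dn B.low c c′ ≢low
          with A.top (∁ Y) in tA
        ... | true = contradiction (subst (λ Z → suc m ≤ B.deg Z) (∁-involutive Y) (topA⇒degB (∁ Y) tA))
                (<⇒≱ (subst (B.deg Y <_) (trans (⋖⇒∣∣ c) (cong suc ∣X∣)) d<∣Y∣))
        ... | false = case trans (sym (B.deg>0⇒¬top Y 0<d))
                (subst (λ Z → B.top Z ≡ true) (∁-involutive Y) (¬topA⇒topB (∁ Y)
                  (∣∁X∣ n≡ Y (trans (⋖⇒∣∣ c) (cong suc ∣X∣))) tA)) of λ ()

      B-not-full : ¬ (∀ X → ∣ X ∣ ≡ m → B.low X ≡ true)
      B-not-full B-full = <⇒≱ 1+low≤N (≤-trans (≤-reflexive (sym (B.card-full B-full))) (m≤n+m s r))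

      lower-defect : LowerDefect m a b
      lower-defect with B.shape
      ... | B.proper q = contradiction q B-not-proper
      ... | B.full q = contradiction q B-not-full
      ... | B.empty q = A.¬top⇒level ¬topA
            , trans (cong suc (trans (A.card-low ¬topA)
                (sym (trans (cong (r +_) (B.card-empty q)) (+-identityʳ r))))) 1+low≡N
            , B.¬low⇒level q
            , λ {X} ∣X∣ → ∧-conicalˡ _ _ (subst (λ Z → B.top Z ≡ true) (∁-involutive X)
                (¬topA⇒topB (∁ X) (∣∁X∣ n≡ X ∣X∣) (¬topA (∁ X))))
        where
        ¬topA : ∀ X → A.top X ≡ false
        -- With no low members in `b` all its degrees are 0, so `topA⇒degB` would give `suc m ≤ 0`.
        ¬topA X = ¬-not λ tX → <⇒≱ z<s (subst (suc m ≤_) (B.deg-empty q (∁ X)) (topA⇒degB X tX))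

    upper-defect : (∀ X → ∣ X ∣ ≡ m → A.low X ≡ true) → (∀ X → B.low X ≡ false) → UpperDefect m a b
    upper-defect A-full B-empty =
        A.¬top⇒level ¬topA
      , (λ {X} ∣X∣ → ∧-conicalˡ _ _ (A-full X ∣X∣))
      , B.¬low⇒level B-empty
      , +-cancelʳ-≡ N (suc (card b)) M (begin
          suc (card b) + N        ≡⟨ cong suc (+-comm (card b) N) ⟩
          suc (N + card b)        ≡⟨ cong (λ x → suc (x + card b)) (trans (A.card-low ¬topA) (A.card-full A-full)) ⟨
          suc (card a + card b)   ≡⟨ total ⟩
          M + N                   ∎)
      where
      open ≡-Reasoning
      ¬topA : ∀ X → A.top X ≡ false
      ¬topA = A.full⇒¬top A-full

Defect : (m : ℕ) (a b : Subset n → Bool) → Set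
Defect m a b = LowerDefect m a b ⊎ UpperDefect m a b

near-optimal : ∀ {m} {a b : Subset n → Bool} → n ≡ suc m + suc m → 1 ≤ m → TwoLayerPair m a b →
  suc (card a + card b) ≡ card (layer {n} (suc m)) + card (layer {n} m) →
  Defect m a b ⊎ Defect m b a
near-optimal {n} {m} {a} {b} n≡ 1≤m P total = by-shape Mid.A.shape Mid.B.shape
  where
  module Mid = Middle n≡ P
  module Mid′ = Middle n≡ (swap-pair n≡ P)
  open Mid using (r; s; N)
  module Near = Mid.NearOptimal total
  module Near′ = Mid′.NearOptimal (trans (cong suc (+-comm (card b) (card a))) total)

  -- This depends on `1 ≤ m`: for `m = 0` the level is just the empty set and `N` is 1. It excludes
  -- the shapes in which both low parts are empty or both are full.
  m+2≤N : suc (suc m) ≤ N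
  m+2≤N = begin
    suc (suc m)       ≡⟨ Mid.n∸m ⟨
    n ∸ m             ≤⟨ ∸-monoʳ-≤ n (pred[n]≤n {m}) ⟩
    n ∸ pred m        ≤⟨ card-layer-lower n (pred m) ⟩
    card (layer {n} (suc (pred m))) ≡⟨ cong (λ k → card (layer {n} k)) (suc-pred m {{>-nonZero 1≤m}}) ⟩
    N                 ∎
    where open ≤-Reasoning

  by-shape : Mid.A.Shape → Mid.B.Shape → Defect m a b ⊎ Defect m b a
  by-shape (Mid.A.proper p) _ = inj₁ (inj₁ (Near.ProperA.lower-defect p))
  by-shape _ (Mid.B.proper p) = inj₂ (inj₁ (Near′.ProperA.lower-defect p))
  by-shape (Mid.A.full p) (Mid.B.empty q) = inj₁ (inj₂ (Near.upper-defect p q))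
  by-shape (Mid.A.empty p) (Mid.B.full q) = inj₂ (inj₂ (Near′.upper-defect q p))
  by-shape (Mid.A.empty p) (Mid.B.empty q) = contradiction Near.N≤1+low (<⇒≱ (begin-strict
    suc (r + s)    ≡⟨ cong₂ (λ x y → suc (x + y)) (Mid.A.card-empty p) (Mid.B.card-empty q) ⟩
    1              <⟨ s≤s (s≤s z≤n) ⟩
    suc (suc m)    ≤⟨ m+2≤N ⟩
    N              ∎))
    where open ≤-Reasoning
  -- Two full levels give `r + s ≡ N + N`, while `slack+low` caps `r + s` at `suc m + N`.
  by-shape (Mid.A.full p) (Mid.B.full q) = contradiction N≤1+m (<⇒≱ m+2≤N)
    where
    open ≤-Reasoning
    N≤1+m : N ≤ suc m
    N≤1+m = +-cancelʳ-≤ N N (suc m) (begin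
      N + N                     ≡⟨ cong₂ _+_ (Mid.A.card-full p) (Mid.B.card-full q) ⟨
      r + s                     ≤⟨ m≤n+m (r + s) (∑ Mid.slack) ⟩
      ∑ Mid.slack + (r + s)     ≡⟨ Near.slack+low ⟩
      suc m + N                 ∎)

-- Reduction to two levels

-- Meeting is phrased as `X ⊈ ∁ Y`, so that it passes to larger sets by transitivity of inclusion.
record CrossPair (α β : Subset n → Bool) : Set where
  field
    α-antichain : Antichain α
    β-antichain : Antichain β
    cross       : ∀ {X Y} → α X ≡ true → β Y ≡ true → X ⊈ ∁ Y

⊆∁-sym : {X Y : Subset n} → X ⊆ ∁ Y → Y ⊆ ∁ X
⊆∁-sym X⊆∁Y y∈Y = x∉p⇒x∈∁p λ y∈X → x∈p⇒x∉∁p y∈Y (X⊆∁Y y∈X)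

swap-cross : {α β : Subset n → Bool} → CrossPair α β → CrossPair β α
swap-cross P = record
  { α-antichain = P.β-antichain
  ; β-antichain = P.α-antichain
  ; cross = λ βX αY X⊆∁Y → P.cross αY βX (⊆∁-sym X⊆∁Y)
  }
  where module P = CrossPair P

∁-antichain : {α : Subset n → Bool} → Antichain α → Antichain (α ∘ ∁)
∁-antichain α-antichain {X} {Y} αX αY X⊆Y = begin
  X         ≡⟨ ∁-involutive X ⟨
  ∁ (∁ X)   ≡⟨ cong ∁ (α-antichain αY αX (p⊆q⇒∁p⊇∁q X⊆Y)) ⟨
  ∁ (∁ Y)   ≡⟨ ∁-involutive Y ⟩
  Y         ∎
  where open ≡-Reasoning

module Bounds {n m} (n≡ : n ≡ suc m + suc m) (1≤m : 1 ≤ m) where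

  M N : ℕ
  M = card (layer {n} (suc m))
  N = card (layer {n} m)

  3≤n : 3 ≤ n
  3≤n = subst (3 ≤_) (sym n≡) (s≤s (subst (2 ≤_) (sym (+-suc m m)) (s≤s (≤-trans 1≤m (m≤m+n m m)))))

  n∸1+m : n ∸ suc m ≡ suc m
  n∸1+m = n∸[n/2] n≡

  HighLevels : (Subset n → Bool) → Set
  HighLevels α = ∀ {X} → α X ≡ true → suc m ≤ ∣ X ∣

  ∁-level≤ : ∀ α → HighLevels α → ∀ {X} → α (∁ X) ≡ true → ∣ X ∣ ≤ suc m
  ∁-level≤ α high {X} αX = subst (∣ X ∣ ≤_) n∸1+m
    (m+n≤o⇒m≤o∸n ∣ X ∣ (subst (_≤ n) (+-comm (suc m) ∣ X ∣)
      (m≤o∸n⇒m+n≤o (suc m) (∣p∣≤n X) (subst (suc m ≤_) (∣∁p∣≡n∸∣p∣ X) (high αX)))))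

  level-cases : ∀ {i} → m ≤ i → i ≤ suc m → i ≡ m ⊎ i ≡ suc m
  level-cases m≤ ≤1+m = map₁ (λ <1+m → ≤-antisym (s≤s⁻¹ <1+m) m≤) (m≤n⇒m<n∨m≡n ≤1+m)

  -- Lowering is raising of the complements: these lie on levels up to `suc m`, and raising them to
  -- level `m` leaves only the two levels.
  module Lower {α : Subset n → Bool} (α-antichain : Antichain α) (high : HighLevels α) where

    lowering : Raising m (α ∘ ∁)
    lowering = raise m (α ∘ ∁) 3≤n (subst (m + m ≤_) (sym n≡) (+-mono-≤ (n≤1+n m) (n≤1+n m)))
      (∁-antichain α-antichain)

    open Raising lowering public

    level : ∀ {X} → raised X ≡ true → ∣ X ∣ ≡ m ⊎ ∣ X ∣ ≡ suc m
    level {X} rX with m <? ∣ X ∣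
    ... | yes m<∣X∣ = level-cases (level≥ rX) (∁-level≤ α high (unchanged rX m<∣X∣))
    ... | no m≮∣X∣ = inj₁ (≤-antisym (≮⇒≥ m≮∣X∣) (level≥ rX))

  module _ {α β : Subset n → Bool} (P : CrossPair α β) (α-high : HighLevels α) (β-high : HighLevels β) where
    open CrossPair P
    private
      module A = Lower α-antichain α-high
      module B = Lower β-antichain β-high

    -- Members on level `suc m` are unchanged by raising to `m`, so a clash of `X` with `∁ X` would
    -- give disjoint members of `α` and `β`.
    lowered : TwoLayerPair m A.raised B.raised
    lowered = record
      { a-antichain = A.antichain
      ; b-antichain = B.antichain
      ; a-level = A.level
      ; b-level = B.level
      ; cross = λ {X} ∣X∣ aX b∁X → cross
          (A.unchanged aX (≤-reflexive (sym ∣X∣)))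
          (trans (cong β (sym (∁-involutive X)))
            (B.unchanged b∁X (≤-reflexive (sym (∣∁X∣ n≡ X ∣X∣)))))
          ⊆-refl
      }

    card-lowered : card A.raised + card B.raised ≤ M + N
    card-lowered = Middle.total≤ n≡ lowered

    high-bound : card α + card β ≤ M + N
    high-bound = ≤-trans (+-mono-≤ (subst (_≤ card A.raised) (∑-∁ (⟦_⟧ ∘ α)) A.card≤)
                                   (subst (_≤ card B.raised) (∑-∁ (⟦_⟧ ∘ β)) B.card≤)) card-lowered

    -- A violating set would make the raising gain two, and a total at most one below `M + N` would
    -- then exceed `card-lowered`.
    near-optimal-low : M + N ≤ suc (card α + card β) → ∀ {X} → α (∁ X) ≡ true → m ≤ ∣ X ∣
    near-optimal-low near {X} αX = ≮⇒≥ λ ∣X∣<m → <-irrefl refl (begin-strict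
      M + N                         ≤⟨ near ⟩
      suc (card α + card β)         <⟨ n<1+n _ ⟩
      2 + card α + card β           ≡⟨ cong₂ (λ x y → 2 + x + y) (∑-∁ (⟦_⟧ ∘ α)) (∑-∁ (⟦_⟧ ∘ β)) ⟨
      2 + card (α ∘ ∁) + card (β ∘ ∁) ≤⟨ +-mono-≤ (A.gain αX ∣X∣<m) B.card≤ ⟩
      card A.raised + card B.raised ≤⟨ card-lowered ⟩
      M + N                         ∎)
      where open ≤-Reasoning

  module _ {α β : Subset n → Bool} (P : CrossPair α β) where
    open CrossPair P
    private
      raise-middle : ∀ {γ} → Antichain γ → Raising (suc m) γ
      raise-middle = raise (suc m) _ 3≤n (≤-reflexive (sym n≡))
      module A = Raising (raise-middle α-antichain)
      module B = Raising (raise-middle β-antichain)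

    raised-pair : CrossPair A.raised B.raised
    raised-pair = record
      { α-antichain = A.antichain
      ; β-antichain = B.antichain
      ; cross = raised-cross
      }
      where
      raised-cross : ∀ {X Y} → A.raised X ≡ true → B.raised Y ≡ true → X ⊈ ∁ Y
      raised-cross rX rY X⊆∁Y with X₀ , αX₀ , X₀⊆X ← A.above rX | Y₀ , βY₀ , Y₀⊆Y ← B.above rY =
        cross αX₀ βY₀ (⊆-trans X₀⊆X (⊆-trans X⊆∁Y (p⊆q⇒∁p⊇∁q Y₀⊆Y)))

    -- The same overshoot at the other end; raising to level `suc m` supplies the level hypotheses
    -- of `high-bound`.
    near-optimal-high : M + N ≤ suc (card α + card β) → HighLevels α
    near-optimal-high near {X} αX = ≮⇒≥ λ ∣X∣<1+m → <-irrefl refl (begin-strict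
      M + N                         ≤⟨ near ⟩
      suc (card α + card β)         <⟨ n<1+n _ ⟩
      2 + card α + card β           ≤⟨ +-mono-≤ (A.gain αX ∣X∣<1+m) B.card≤ ⟩
      card A.raised + card B.raised ≤⟨ high-bound raised-pair A.level≥ B.level≥ ⟩
      M + N                         ∎)
      where open ≤-Reasoning

  -- Levels below the middle are excluded first, because the argument for the levels above
  -- `n / 2 + 1` assumes both families to lie at or above the middle.
  near-optimal-defect : ∀ {α β} → CrossPair α β → suc (card α + card β) ≡ M + N →
    Defect m (α ∘ ∁) (β ∘ ∁) ⊎ Defect m (β ∘ ∁) (α ∘ ∁)
  near-optimal-defect {α} {β} P total = near-optimal n≡ 1≤m pair
    (trans (cong suc (cong₂ _+_ (∑-∁ (⟦_⟧ ∘ α)) (∑-∁ (⟦_⟧ ∘ β)))) total)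
    where
    open CrossPair P
    near : M + N ≤ suc (card α + card β)
    near = ≤-reflexive (sym total)
    near′ : M + N ≤ suc (card β + card α)
    near′ = subst (λ t → M + N ≤ suc t) (+-comm (card α) (card β)) near
    α-high : HighLevels α
    α-high = near-optimal-high P near
    β-high : HighLevels β
    β-high = near-optimal-high (swap-cross P) near′
    pair : TwoLayerPair m (α ∘ ∁) (β ∘ ∁)
    pair = record
      { a-antichain = ∁-antichain α-antichain
      ; b-antichain = ∁-antichain β-antichain
      ; a-level = λ αX → level-cases (near-optimal-low P α-high β-high near αX) (∁-level≤ α α-high αX)
      ; b-level = λ βX → level-cases (near-optimal-low (swap-cross P) β-high α-high near′ βX) (∁-level≤ β β-high βX)
      ; cross = λ {X} _ αX βX → cross αX βX (⊆-reflexive (sym (∁-involutive (∁ X))))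
      }

-- Families as Boolean predicates

open module Membership {n} = DecMembership (≡-dec {n = n} _≟ᵇ_) using (_∈?_)

∈ᵇ : List (Subset n) → Subset n → Bool
∈ᵇ xs X = ⌊ X ∈? xs ⌋

∈ᵇ⇒ : ∀ (xs : List (Subset n)) {X} → ∈ᵇ xs X ≡ true → X ∈ₗ xs
∈ᵇ⇒ xs {X} e with X ∈? xs
... | yes X∈xs = X∈xs

∈ᵇ⇐ : ∀ {xs : List (Subset n)} {X} → X ∈ₗ xs → ∈ᵇ xs X ≡ true
∈ᵇ⇐ {xs = xs} {X} X∈xs with X ∈? xs
... | yes _ = refl
... | no X∉xs = contradiction X∈xs X∉xs

∑-point : ∀ (f : Subset n → ℕ) X → (∀ Y → Y ≢ X → f Y ≡ 0) → ∑ f ≡ f X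
∑-point f [] _ = refl
∑-point {suc n} f (outside ∷ X) f≡0 = trans (cong₂ _+_
  (∑-point (f ∘ (outside ∷_)) X (λ Y Y≢X → f≡0 _ λ { refl → Y≢X refl }))
  (trans (∑-cong (λ Y → f≡0 (inside ∷ Y) λ ())) (∑-0 n))) (+-identityʳ _)
∑-point {suc n} f (inside ∷ X) f≡0 = cong₂ _+_
  (trans (∑-cong (λ Y → f≡0 (outside ∷ Y) λ ())) (∑-0 n))
  (∑-point (f ∘ (inside ∷_)) X (λ Y Y≢X → f≡0 _ λ { refl → Y≢X refl }))

card-∈ᵇ : {xs : List (Subset n)} → Unique xs → card (∈ᵇ xs) ≡ length xs
card-∈ᵇ {n} {[]} [] = ∑-0 n
card-∈ᵇ {n} {x ∷ xs} (x∉xs ∷ xs-unique) = begin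
  card (∈ᵇ (x ∷ xs))                                    ≡⟨ ∑-cong split ⟩
  ∑ (λ X → ⟦ ⌊ ≡-dec _≟ᵇ_ X x ⌋ ⟧ + ⟦ ∈ᵇ xs X ⟧)        ≡⟨ ∑-+ (λ X → ⟦ ⌊ ≡-dec _≟ᵇ_ X x ⌋ ⟧) (⟦_⟧ ∘ ∈ᵇ xs) ⟩
  ∑ (λ X → ⟦ ⌊ ≡-dec _≟ᵇ_ X x ⌋ ⟧) + card (∈ᵇ xs)       ≡⟨ cong₂ _+_ (trans (∑-point _ x off-x) at-x) (card-∈ᵇ xs-unique) ⟩
  suc (length xs)                                       ∎
  where
  open ≡-Reasoning
  split : ∀ X → ⟦ ∈ᵇ (x ∷ xs) X ⟧ ≡ ⟦ ⌊ ≡-dec _≟ᵇ_ X x ⌋ ⟧ + ⟦ ∈ᵇ xs X ⟧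
  split X with ≡-dec _≟ᵇ_ X x | X ∈? xs
  ... | yes refl | yes X∈xs = contradiction refl (All.lookup x∉xs X∈xs)
  ... | yes refl | no _ = refl
  ... | no _ | yes _ = refl
  ... | no _ | no _ = refl
  off-x : ∀ Y → Y ≢ x → ⟦ ⌊ ≡-dec _≟ᵇ_ Y x ⌋ ⟧ ≡ 0
  off-x Y Y≢x with ≡-dec _≟ᵇ_ Y x
  ... | yes Y≡x = contradiction Y≡x Y≢x
  ... | no _ = refl
  at-x : ⟦ ⌊ ≡-dec _≟ᵇ_ x x ⌋ ⟧ ≡ 1
  at-x with ≡-dec _≟ᵇ_ x x
  ... | yes _ = refl
  ... | no x≢x = contradiction refl x≢x

χ : Family n → Subset n → Bool
χ 𝒜 = ∈ᵇ (sets 𝒜)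

card-χ : (𝒜 : Family n) → card (χ 𝒜) ≡ size 𝒜
card-χ 𝒜 = card-∈ᵇ (unique 𝒜)

layer⊆⇒size≥ : ∀ (𝒜 : Family n) k → (∀ {X} → ∣ X ∣ ≡ k → Members 𝒜 X) → n C k ≤ size 𝒜
layer⊆⇒size≥ {n} 𝒜 k sup = begin
  n C k          ≡⟨ card-layer n k ⟨
  card (layer {n} k) ≤⟨ ∑-mono pointwise ⟩
  card (χ 𝒜)     ≡⟨ card-χ 𝒜 ⟩
  size 𝒜         ∎
  where
  open ≤-Reasoning
  pointwise : ∀ X → ⟦ layer k X ⟧ ≤ ⟦ χ 𝒜 X ⟧
  pointwise X with layer k X in eq
  ... | false = z≤n
  ... | true = ≤-reflexive (cong ⟦_⟧ (sym (∈ᵇ⇐ (sup (layer⇒ k X eq)))))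

⊆layer⇒size≤ : ∀ (𝒜 : Family n) k → (∀ {X} → Members 𝒜 X → ∣ X ∣ ≡ k) → size 𝒜 ≤ n C k
⊆layer⇒size≤ {n} 𝒜 k sub = begin
  size 𝒜         ≡⟨ card-χ 𝒜 ⟨
  card (χ 𝒜)     ≤⟨ ∑-mono pointwise ⟩
  card (layer {n} k) ≡⟨ card-layer n k ⟩
  n C k          ∎
  where
  open ≤-Reasoning
  pointwise : ∀ X → ⟦ χ 𝒜 X ⟧ ≤ ⟦ layer k X ⟧
  pointwise X with χ 𝒜 X in eq
  ... | false = z≤n
  ... | true rewrite layer⇐ k X (sub (∈ᵇ⇒ (sets 𝒜) eq)) = ≤-refl

≐layer⇒size≡ : ∀ (𝒜 : Family n) k → Members 𝒜 ≐ Layer k → size 𝒜 ≡ n C k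
≐layer⇒size≡ 𝒜 k (sub , sup) = ≤-antisym (⊆layer⇒size≤ 𝒜 k sub) (layer⊆⇒size≥ 𝒜 k sup)

cross-pair : (𝒜 ℬ : Family n) → Sperner 𝒜 → Sperner ℬ → CrossIntersecting 𝒜 ℬ → CrossPair (χ 𝒜) (χ ℬ)
cross-pair 𝒜 ℬ 𝒜-sperner ℬ-sperner 𝒜ℬ-cross = record
  { α-antichain = sperner⇒antichain 𝒜 𝒜-sperner
  ; β-antichain = sperner⇒antichain ℬ ℬ-sperner
  ; cross = λ {X} {Y} αX βY X⊆∁Y → case 𝒜ℬ-cross (∈ᵇ⇒ (sets 𝒜) αX) (∈ᵇ⇒ (sets ℬ) βY) of λ where
      (_ , x∈X∩Y) → case x∈p∩q⁻ X Y x∈X∩Y of λ where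
        (x∈X , x∈Y) → x∈p⇒x∉∁p x∈Y (X⊆∁Y x∈X)
  }
  where
  sperner⇒antichain : ∀ 𝒞 → Sperner 𝒞 → Antichain (χ 𝒞)
  sperner⇒antichain 𝒞 𝒞-sperner {X} {Y} X∈𝒞 Y∈𝒞 X⊆Y with ≡-dec _≟ᵇ_ X Y
  ... | yes X≡Y = X≡Y
  ... | no X≢Y = contradiction (λ {x} → X⊆Y {x}) (𝒞-sperner (∈ᵇ⇒ (sets 𝒞) X∈𝒞) (∈ᵇ⇒ (sets 𝒞) Y∈𝒞) X≢Y)

∁-members⊆ : ∀ (𝒜 : Family n) {j} → (∀ {X} → χ 𝒜 (∁ X) ≡ true → ∣ X ∣ ≡ j) →
  ∀ {X} → Members 𝒜 X → ∣ X ∣ ≡ n ∸ j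
∁-members⊆ {n} 𝒜 {j} level {X} X∈𝒜 = begin
  ∣ X ∣            ≡⟨ cong ∣_∣ (∁-involutive X) ⟨
  ∣ ∁ (∁ X) ∣      ≡⟨ ∣∁p∣≡n∸∣p∣ (∁ X) ⟩
  n ∸ ∣ ∁ X ∣      ≡⟨ cong (n ∸_) (level (trans (cong (χ 𝒜) (∁-involutive X)) (∈ᵇ⇐ X∈𝒜))) ⟩
  n ∸ j            ∎
  where open ≡-Reasoning

∁-members⊇ : ∀ (𝒜 : Family n) {j} → j ≤ n → (∀ {X} → ∣ X ∣ ≡ j → χ 𝒜 (∁ X) ≡ true) →
  ∀ {X} → ∣ X ∣ ≡ n ∸ j → Members 𝒜 X
∁-members⊇ {n} 𝒜 j≤n level {X} ∣X∣ = ∈ᵇ⇒ (sets 𝒜) (trans (cong (χ 𝒜) (sym (∁-involutive X)))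
  (level (trans (∣∁p∣≡n∸∣p∣ X) (trans (cong (n ∸_) ∣X∣) (m∸[m∸n]≡n j≤n)))))

-- Extremal with n / 2 and n / 2 + 1 abstracted, so that they can be matched on.
ExtremalAt : ∀ {n} (k l : ℕ) → Family n → Family n → Set
ExtremalAt {n} k l 𝒜 ℬ =
  ((Members 𝒜 ≐ Layer k) × (Members ℬ ⊂ Layer l) × (size ℬ ≡ n C l ∸ 1)) ⊎
  ((Members 𝒜 ⊂ Layer k) × (size 𝒜 ≡ n C k ∸ 1) × (Members ℬ ≐ Layer l))

-- The characterization of equality

module Characterization {n m} (n≡ : n ≡ suc m + suc m) (1≤m : 1 ≤ m) where

  k l : ℕ
  k = suc m
  l = suc (suc m)

  n∸k : n ∸ k ≡ k
  n∸k = n∸[n/2] n≡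

  k≤n : k ≤ n
  k≤n = subst (k ≤_) (sym n≡) (m≤m+n k k)

  m≤n : m ≤ n
  m≤n = <⇒≤ k≤n

  n∸m : n ∸ m ≡ l
  n∸m = n∸[n/2-1] n≡

  l≤n : l ≤ n
  l≤n = subst (_≤ n) n∸m (m∸n≤m n m)

  nCm≡nCl : n C m ≡ n C l
  nCm≡nCl = trans (nCk≡nC[n∸k] m≤n) (cong (n C_) n∸m)

  nC>0 : ∀ {j} → j ≤ n → 1 ≤ n C j
  nC>0 {j} j≤n = subst (1 ≤_) (card-layer n j) (card-layer-pos j≤n)

  strict : ∀ (𝒜 : Family n) {j} → suc (size 𝒜) ≡ n C j → ¬ (∀ {X} → ∣ X ∣ ≡ j → Members 𝒜 X)
  strict 𝒜 {j} 1+size sup = <⇒≱ (≤-reflexive 1+size) (layer⊆⇒size≥ 𝒜 j sup)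

  suc-size : ∀ (𝒜 : Family n) {c} → suc (card (χ 𝒜 ∘ ∁)) ≡ c → suc (size 𝒜) ≡ c
  suc-size 𝒜 = trans (cong suc (sym (trans (∑-∁ (⟦_⟧ ∘ χ 𝒜)) (card-χ 𝒜))))

  -- The roles are exchanged: the family whose complements lie on level `m` itself lies on level
  -- `l`, hence comes second in `ExtremalAt`.
  defect⇒extremal : (𝒜 ℬ : Family n) → Defect m (χ 𝒜 ∘ ∁) (χ ℬ ∘ ∁) → ExtremalAt k l ℬ 𝒜
  defect⇒extremal 𝒜 ℬ (inj₁ (a⊆ , 1+a , b⊆ , b⊇)) = inj₁
    ( ( (λ B∈ → trans (∁-members⊆ ℬ b⊆ B∈) n∸k)
      , (λ ∣B∣ → ∁-members⊇ ℬ k≤n b⊇ (trans ∣B∣ (sym n∸k))))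
    , ( (λ A∈ → trans (∁-members⊆ 𝒜 a⊆ A∈) n∸m) , strict 𝒜 1+size)
    , cong pred 1+size)
    where
    1+size : suc (size 𝒜) ≡ n C l
    1+size = suc-size 𝒜 (trans 1+a (trans (card-layer n m) nCm≡nCl))
  defect⇒extremal 𝒜 ℬ (inj₂ (a⊆ , a⊇ , b⊆ , 1+b)) = inj₂
    ( ( (λ B∈ → trans (∁-members⊆ ℬ b⊆ B∈) n∸k) , strict ℬ 1+size)
    , cong pred 1+size
    , ( (λ A∈ → trans (∁-members⊆ 𝒜 a⊆ A∈) n∸m)
      , (λ ∣A∣ → ∁-members⊇ 𝒜 m≤n a⊇ (trans ∣A∣ (sym n∸m)))))
    where
    1+size : suc (size ℬ) ≡ n C k
    1+size = suc-size ℬ (trans 1+b (card-layer n k))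

  extremal⇒size : (𝒜 ℬ : Family n) → ExtremalAt k l 𝒜 ℬ → size 𝒜 + size ℬ ≡ n C k + n C l ∸ 1
  extremal⇒size 𝒜 ℬ (inj₁ (𝒜≐ , _ , ∣ℬ∣)) = trans (cong₂ _+_ (≐layer⇒size≡ 𝒜 k 𝒜≐) ∣ℬ∣)
    (sym (+-∸-assoc (n C k) (nC>0 l≤n)))
  extremal⇒size 𝒜 ℬ (inj₂ (_ , ∣𝒜∣ , ℬ≐)) = trans (cong₂ _+_ ∣𝒜∣ (≐layer⇒size≡ ℬ l ℬ≐))
    (sym (+-∸-comm (n C l) (nC>0 k≤n)))

  characterization : (𝒜 ℬ : Family n) → Sperner 𝒜 → Sperner ℬ → CrossIntersecting 𝒜 ℬ →
    (size 𝒜 + size ℬ ≡ n C k + n C l ∸ 1) ⇔ (ExtremalAt k l 𝒜 ℬ ⊎ ExtremalAt k l ℬ 𝒜)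
  characterization 𝒜 ℬ 𝒜-sperner ℬ-sperner 𝒜ℬ-cross = mk⇔ to from
    where
    to : size 𝒜 + size ℬ ≡ n C k + n C l ∸ 1 → ExtremalAt k l 𝒜 ℬ ⊎ ExtremalAt k l ℬ 𝒜
    to total = swap (map (defect⇒extremal 𝒜 ℬ) (defect⇒extremal ℬ 𝒜)
      (Bounds.near-optimal-defect n≡ 1≤m (cross-pair 𝒜 ℬ 𝒜-sperner ℬ-sperner 𝒜ℬ-cross) total′))
      where
      open ≡-Reasoning
      total′ : suc (card (χ 𝒜) + card (χ ℬ)) ≡ card (layer {n} k) + card (layer {n} m)
      total′ = begin
        suc (card (χ 𝒜) + card (χ ℬ))   ≡⟨ cong₂ (λ x y → suc (x + y)) (card-χ 𝒜) (card-χ ℬ) ⟩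
        suc (size 𝒜 + size ℬ)           ≡⟨ cong suc total ⟩
        -- The truncated subtraction is genuine because `n C k` is positive.
        suc (n C k + n C l ∸ 1)         ≡⟨ m+[n∸m]≡n (≤-trans (nC>0 k≤n) (m≤m+n (n C k) (n C l))) ⟩
        n C k + n C l                   ≡⟨ cong₂ _+_ (card-layer n k) (trans (card-layer n m) nCm≡nCl) ⟨
        card (layer {n} k) + card (layer {n} m) ∎
    from : ExtremalAt k l 𝒜 ℬ ⊎ ExtremalAt k l ℬ 𝒜 → size 𝒜 + size ℬ ≡ n C k + n C l ∸ 1
    from (inj₁ e) = extremal⇒size 𝒜 ℬ e
    from (inj₂ e) = trans (+-comm (size 𝒜) (size ℬ)) (extremal⇒size ℬ 𝒜 e)

characterization-at : ∀ {n k l} → n ≡ k + k → l ≡ suc k → 4 ≤ n →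
  (𝒜 ℬ : Family n) → Sperner 𝒜 → Sperner ℬ → CrossIntersecting 𝒜 ℬ →
  (size 𝒜 + size ℬ ≡ n C k + n C l ∸ 1) ⇔ (ExtremalAt k l 𝒜 ℬ ⊎ ExtremalAt k l ℬ 𝒜)
characterization-at {k = 0} refl _ ()
characterization-at {k = 1} refl _ (s≤s (s≤s ()))
-- The parameter `m` of `Characterization` is `suc m` here, so `z<s` proves that it is at least 1.
characterization-at {k = suc (suc m)} n≡ refl _ = Characterization.characterization n≡ z<s

theorem1p6 : (n : ℕ) → 4 ≤ n → 2 ∣ n →
    (𝒜 ℬ : Family n) → Sperner 𝒜 → Sperner ℬ → CrossIntersecting 𝒜 ℬ →
    (size 𝒜 + size ℬ ≡ ((n C (n / 2)) + (n C (n / 2 + 1))) ∸ 1)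
    ⇔ (Extremal 𝒜 ℬ ⊎ Extremal ℬ 𝒜)
theorem1p6 n 4≤n (divides q n≡q*2) = characterization-at n≡ (+-comm (n / 2) 1) 4≤n
  where
  open ≡-Reasoning
  n≡ : n ≡ n / 2 + n / 2
  n≡ = begin
    n               ≡⟨ n≡q*2 ⟩
    q * 2           ≡⟨ *-comm q 2 ⟩
    q + (q + 0)     ≡⟨ cong (q +_) (+-identityʳ q) ⟩
    q + q           ≡⟨ cong₂ _+_ half half ⟨
    n / 2 + n / 2   ∎
    where
    half : n / 2 ≡ q
    half = trans (cong (_/ 2) n≡q*2) (m*n/n≡m q 2)
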